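{- Let $g(x)=\frac{x}{x+1}$ for $x\ge 0$. For all integers $n>0$ and $m$ with $0\le m\le\binom n2$, the quasi-complete graph $QK(n,m)$ uniquely minimizes $\Sigma_g$ over $\mathbb{G}(n,m)$.
   Context: Graphs are finite and simple, with vertex set $\{1,\dots,n\}$; $\mathbb{G}(n,m)$ is the set of graphs with $n$ vertices and $m$ edges. For a graph with degree sequence $d=(d_1,\dots,d_n)$, $\Sigma_g(d)=\sum_{i=1}^n g(d_i)$. A graph $G\in\mathbb{G}(n,m)$ uniquely minimizes $\Sigma_g$ over $\mathbb{G}(n,m)$ if its degree sequence attains the minimum of $\Sigma_g$ among all degree sequences of graphs in $\mathbb{G}(n,m)$ and, up to isomorphism, $G$ is the only graph in $\mathbb{G}(n,m)$ whose degree sequence does so. $QK(n,m)$ is the graph on $\{1,\dots,n\}$ such that, with $q,r$ the unique integers satisfying $m=\binom q2+r$, $0\le r\le q-1$, the vertices $1,\dots,q$ induce a complete graph, vertex $q+1$ (if $q<n$) is adjacent exactly to $1,\dots,r$, and vertices $q+2,\dots,n$ are isolated. -}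

module Defs where

open import Data.Bool.Base using (Bool; false; if_then_else_; _∧_)
open import Data.Fin.Base using (Fin; toℕ)
open import Data.Fin.Permutation using (Permutation′; _⟨$⟩ʳ_)
open import Data.Fin.Properties using (_<?_)
open import Data.Integer.Base using (+_)
open import Data.Nat.Base as ℕ using (ℕ; zero; suc; z≤n; s≤s)
open import Data.Nat.Combinatorics using (_C_; nCk+nC[k+1]≡[n+1]C[k+1]; nC1≡n)
import Data.Nat.Properties as ℕ
open import Data.Product.Base using (Σ; _×_; _,_)
open import Data.Rational.Base using (ℚ; _/_; _≤_)
import Data.Rational.Properties as ℚ
open import Data.Sum.Base using (_⊎_; inj₁; inj₂)
open import Data.Vec.Functional using (Vector)
open import Function.Base using (_∘_)
open import Function.Bundles using (mk⇔)
open import Relation.Binary.Definitions using (tri<; tri≈; tri>)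
open import Relation.Binary.PropositionalEquality
  using (_≡_; _≢_; refl; sym; trans; cong; module ≡-Reasoning)
open import Relation.Nullary using (Dec; does; contradiction)
open import Relation.Nullary.Decidable
  using (_×-dec_; _⊎-dec_; ¬?; does-⇔; dec-false)

open import Algebra.Properties.CommutativeMonoid.Sum ℕ.+-0-commutativeMonoid
  using () renaming (sum to sumℕ)
open import Algebra.Properties.CommutativeMonoid.Sum ℚ.+-0-commutativeMonoid
  using () renaming (sum to sumℚ)

-- The vertices 1, …, n are represented by the elements 0, …, n - 1 of Fin n.

record Graph (n : ℕ) : Set where
  field
    adj        : Fin n → Fin n → Bool
    adj-sym    : ∀ i j → adj i j ≡ adj j i
    adj-irrefl : ∀ i → adj i i ≡ false

open Graph public

card : ∀ {n} → (Fin n → Bool) → ℕ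
card p = sumℕ λ i → if p i then 1 else 0

degree : ∀ {n} → Graph n → Vector ℕ n
degree G i = card (adj G i)

-- Each edge {i , j} is counted once, at its smaller end i.
edgeCount : ∀ {n} → Graph n → ℕ
edgeCount G = sumℕ λ i → card λ j → does (i <? j) ∧ adj G i j

infix 4 _∈𝔾_ _≅_

_∈𝔾_ : ∀ {n} → Graph n → ℕ → Set
G ∈𝔾 m = edgeCount G ≡ m

_≅_ : ∀ {n} → Graph n → Graph n → Set
_≅_ {n} G H = Σ (Permutation′ n) λ π →
  ∀ i j → adj G i j ≡ adj H (π ⟨$⟩ʳ i) (π ⟨$⟩ʳ j)

-- Only the values of g at degrees, that is at natural numbers, matter.
Σ[_] : (ℕ → ℚ) → ∀ {n} → Vector ℕ n → ℚ
Σ[ g ] d = sumℚ (g ∘ d)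

Minimizes : (ℕ → ℚ) → ∀ {n} → ℕ → Graph n → Set
Minimizes g {n} m G =
  G ∈𝔾 m × (∀ (H : Graph n) → H ∈𝔾 m → Σ[ g ] (degree G) ≤ Σ[ g ] (degree H))

UniquelyMinimizes : (ℕ → ℚ) → ∀ {n} → ℕ → Graph n → Set
UniquelyMinimizes g {n} m G =
  Minimizes g m G × (∀ (H : Graph n) → Minimizes g m H → H ≅ G)

g : ℕ → ℚ
g x = + x / suc x

-- r < q rather than r ≤ q ∸ 1: with truncated subtraction the latter would
-- also admit q = r = 0.
record Decomposition (m : ℕ) : Set where
  constructor decomposition
  field
    q r  : ℕ
    m≡   : m ≡ q C 2 ℕ.+ r
    r<q  : r ℕ.< q

[1+q]C2≡qC2+q : ∀ q → suc q C 2 ≡ q C 2 ℕ.+ q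
[1+q]C2≡qC2+q q = begin
  suc q C 2           ≡⟨ nCk+nC[k+1]≡[n+1]C[k+1] q 1 ⟨
  q C 1 ℕ.+ q C 2     ≡⟨ cong (ℕ._+ q C 2) (nC1≡n q) ⟩
  q ℕ.+ q C 2         ≡⟨ ℕ.+-comm q (q C 2) ⟩
  q C 2 ℕ.+ q         ∎
  where open ≡-Reasoning

decompose : ∀ m → Decomposition m
decompose zero    = decomposition 1 0 refl (s≤s z≤n)
decompose (suc m) with decompose m
... | decomposition q r m≡ r<q with ℕ.m≤n⇒m<n∨m≡n r<q
...   | inj₁ 1+r<q =
        decomposition q (suc r)
          (trans (cong suc m≡) (sym (ℕ.+-suc (q C 2) r))) 1+r<q
...   | inj₂ refl  =
        decomposition (suc q) 0
          (trans (cong suc m≡)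
            (trans (sym (ℕ.+-suc (q C 2) r))
              (trans (sym ([1+q]C2≡qC2+q q)) (sym (ℕ.+-identityʳ _)))))
          (s≤s z≤n)

C2-mono : ∀ {p q} → p ℕ.≤′ q → p C 2 ℕ.≤ q C 2
C2-mono ℕ.≤′-refl               = ℕ.≤-refl
C2-mono (ℕ.≤′-step {n = q} p≤q) = ℕ.≤-trans (C2-mono p≤q)
  (ℕ.≤-trans (ℕ.m≤m+n (q C 2) q) (ℕ.≤-reflexive (sym ([1+q]C2≡qC2+q q))))

decomposition-< : ∀ {q q′ r r′} → r ℕ.< q → q ℕ.< q′ →
                  q C 2 ℕ.+ r ℕ.< q′ C 2 ℕ.+ r′
decomposition-< {q} {q′} {r} {r′} r<q q<q′ = begin-strict
  q C 2 ℕ.+ r    <⟨ ℕ.+-monoʳ-< (q C 2) r<q ⟩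
  q C 2 ℕ.+ q    ≡⟨ [1+q]C2≡qC2+q q ⟨
  suc q C 2      ≤⟨ C2-mono (ℕ.≤⇒≤′ q<q′) ⟩
  q′ C 2         ≤⟨ ℕ.m≤m+n (q′ C 2) r′ ⟩
  q′ C 2 ℕ.+ r′  ∎
  where open ℕ.≤-Reasoning

decomposition-unique : ∀ {m} (D E : Decomposition m) →
  let module D = Decomposition D; module E = Decomposition E in
  D.q ≡ E.q × D.r ≡ E.r
decomposition-unique (decomposition q r m≡ r<q) (decomposition q′ r′ m≡′ r′<q′)
  with ℕ.<-cmp q q′
... | tri< q<q′ _ _ =
      contradiction (trans (sym m≡) m≡′) (ℕ.<⇒≢ (decomposition-< r<q q<q′))
... | tri> _ _ q′<q =
      contradiction (trans (sym m≡′) m≡) (ℕ.<⇒≢ (decomposition-< r′<q′ q′<q))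
... | tri≈ _ refl _ =
      refl , ℕ.+-cancelˡ-≡ (q C 2) r r′ (trans (sym m≡) m≡′)

-- In this numbering from 0, the vertices 1, …, q become those below q, and
-- the vertex q + 1 becomes q itself.
QKAdj : (q r : ℕ) → ℕ → ℕ → Set
QKAdj q r i j =
  i ≢ j × ((i ℕ.< q × j ℕ.< q) ⊎ (i ≡ q × j ℕ.< r) ⊎ (j ≡ q × i ℕ.< r))

QKAdj? : ∀ q r i j → Dec (QKAdj q r i j)
QKAdj? q r i j =
  ¬? (i ℕ.≟ j) ×-dec
  ((i ℕ.<? q ×-dec j ℕ.<? q) ⊎-dec
   ((i ℕ.≟ q ×-dec j ℕ.<? r) ⊎-dec (j ℕ.≟ q ×-dec i ℕ.<? r)))

QKAdj-sym : ∀ {q r i j} → QKAdj q r i j → QKAdj q r j i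
QKAdj-sym (i≢j , inj₁ (i<q , j<q)) = i≢j ∘ sym , inj₁ (j<q , i<q)
QKAdj-sym (i≢j , inj₂ (inj₁ p))    = i≢j ∘ sym , inj₂ (inj₂ p)
QKAdj-sym (i≢j , inj₂ (inj₂ p))    = i≢j ∘ sym , inj₂ (inj₁ p)

-- Meaningful for m ≤ n C 2, which forces q ≤ n, and r = 0 if q = n.
QK : ∀ n m → Graph n
QK n m = record
  { adj        = λ i j → does (QKAdj? q r (toℕ i) (toℕ j))
  ; adj-sym    = λ i j → does-⇔ (mk⇔ QKAdj-sym QKAdj-sym)
                           (QKAdj? q r (toℕ i) (toℕ j))
                           (QKAdj? q r (toℕ j) (toℕ i))
  ; adj-irrefl = λ i → dec-false (QKAdj? q r (toℕ i) (toℕ i))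
                         (λ (i≢i , _) → i≢i refl)
  }
  where open Decomposition (decompose m) using (q; r)

{-# OPTIONS --safe #-}

-- Since x/(x+1) = 1 - 1/(x+1), minimizing Σ_g means maximizing Σ 1/(d_i+1).
-- Let w be a non-isolated vertex of minimum degree δ. If the other non-isolated
-- vertices form a clique, the graph is quasi-complete. Otherwise, among those
-- that miss some non-isolated vertex other than w, choose w′ of minimum degree
-- D, and replace as many edges at w as possible by edges from w′ to vertices
-- that it misses. Moving j edges changes the sum by at least
--   1/(δ-j+1) - 1/(δ+1) + j/(P(P+1)) - (1/(D+1) - 1/(D+j+1)) - j/((D+1)(D+2)),
-- where P + 1 is the number of non-isolated vertices, so that all degrees are at
-- most P. This is positive: either j = δ, or w′ becomes adjacent to all
-- non-isolated vertices except possibly w, so that P ≤ D + j + 1.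

module Submission where

open import Defs
open import Data.Bool.Base using (Bool; true; false; if_then_else_; _∧_; _∨_; not)
open import Data.Bool.Properties
  using (∧-conicalˡ; ∧-conicalʳ; ∧-zeroʳ; ∨-comm; not-injective; ¬-not)
open import Data.Fin.Base using (Fin; zero; suc; toℕ; punchIn)
open import Data.Fin.Permutation as Perm
  using (Permutation′; _⟨$⟩ʳ_; _⟨$⟩ˡ_; inverseˡ)
open import Data.Fin.Properties
  using (_≟_; _<?_; <-cmp; toℕ<n; toℕ-injective; toℕ-fromℕ; toℕ-inject₁)
import Data.Integer.Base as ℤ
import Data.Integer.Properties as ℤ
import Data.Integer.Tactic.RingSolver as ℤSolver
open import Data.Nat.Base
open import Data.Nat.Combinatorics using (_C_)
open import Data.Nat.Divisibility using (m∣m*n; ∣-trans; m≤n⇒m!∣n!)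
open import Data.Nat.DivMod using (_/_; m/n*n≡m; /-monoʳ-≤)
open import Data.Nat.Induction using (<-wellFounded)
import Data.Nat.Properties as ℕ
open import Data.Nat.Tactic.RingSolver using (solve-∀)
open import Data.Product.Base using (Σ; ∃; _×_; _,_; proj₁; proj₂)
import Data.Rational.Base as ℚ
import Data.Rational.Properties as ℚ
open import Data.Rational.Unnormalised.Base as ℚᵘ using (mkℚᵘ; *≡*; *≤*)
import Data.Rational.Unnormalised.Properties as ℚᵘ
open import Data.Sum.Base using (_⊎_; inj₁; inj₂)
open import Function.Base using (_∘_)
open import Function.Bundles using (mk⇔)
open import Induction.WellFounded using (Acc; acc)
open import Relation.Binary.Definitions using (tri<; tri≈; tri>)
open import Relation.Binary.PropositionalEquality
open import Relation.Nullary using (Dec; yes; no; does; ¬_; contradiction)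
open import Relation.Nullary.Decidable using (dec-true; dec-false; does-⇔; _×-dec_)

open import Algebra.Properties.Semiring.Sum ℕ.+-*-semiring
  using (sum-cong-≗; ∑-distrib-+; ∑-comm; sum-permute; sum-remove;
         sum-init-last; sum-replicate-zero; *-distribʳ-sum)
  renaming (sum to sumℕ)
open import Algebra.Properties.CommutativeMonoid.Sum ℚ.+-0-commutativeMonoid
  using () renaming (sum to sumℚ; sum-cong-≗ to sumℚ-cong-≗)

-- Moving a single edge would not do: for j = 1 and δ = D the bound equals (2-D)/(D(D+1)(D+2)) +
-- 1/(P(P+1)), which is negative when D > 2 and P is large. This is why many edges are moved at
-- once.
--
-- The terms linear in j come from the convexity of 1/(x+1). A vertex that loses an edge has degree
-- at most P, so it contributes at least 1/P - 1/(P+1). A non-isolated vertex other than w that w′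
-- misses also misses w′, so by the choice of w′ its degree is at least D, and the edge it gains
-- costs at most 1/(D+1) - 1/(D+2). The same accounting remains valid for a vertex that both loses
-- and gains an edge, and for w′ when it loses its edge to w, so neither case has to be avoided.

-- Scaled reciprocals and the inequality behind the gain

module Reciprocals (N : ℕ) where

  open import Data.Nat.Properties
  -- A common denominator of all 1/(x+1) with `x < N`. Scaling by it keeps the estimates in the
  -- natural numbers, where the descent is well-founded.
  L : ℕ
  L = N !

  instance
    L≢0 : NonZero L
    L≢0 = N !≢0

  -- c x is exactly L / (x + 1) for x < N; beyond that it is only a floor.
  c : ℕ → ℕ
  c x = L / suc x

  c-inverse : ∀ {x} → x < N → c x * suc x ≡ L
  c-inverse {x} x<N = m/n*n≡m (∣-trans (m∣m*n (x !)) (m≤n⇒m!∣n! x<N))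

  c-antitone : ∀ {x y} → x ≤ y → c y ≤ c x
  c-antitone x≤y = /-monoʳ-≤ L (s≤s x≤y)

  c-positive : ∀ {x} → x < N → 0 < c x
  c-positive {x} x<N = n≢0⇒n>0 λ cx≡0 →
    ≢-nonZero⁻¹ L (trans (sym (c-inverse x<N)) (cong (_* suc x) cx≡0))

  c-strict : ∀ {x y} → x < y → y < N → c y < c x
  c-strict {x} {y} x<y y<N = ≰⇒> λ cx≤cy → <-irrefl refl (begin-strict
    L           ≡⟨ c-inverse (<-trans x<y y<N) ⟨
    c x * suc x ≤⟨ *-monoˡ-≤ (suc x) cx≤cy ⟩
    c y * suc x <⟨ *-monoʳ-< (c y) {{>-nonZero (c-positive y<N)}} (s≤s x<y) ⟩
    c y * suc y ≡⟨ c-inverse y<N ⟩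
    L           ∎)
    where open ≤-Reasoning

  -- Partial fractions, 1/(x+1) - 1/(x+j+1) = j/((x+1)(x+j+1)), with the subtraction moved across.
  -- The factor `j` is what can later be divided out of the whole gain.
  c-gap : ∀ x j → x + j < N → L * c x ≡ L * c (x + j) + j * (c x * c (x + j))
  c-gap x j x+j<N = begin
    L * c x                                   ≡⟨ cong (_* c x) (c-inverse x+j<N) ⟨
    c (x + j) * suc (x + j) * c x             ≡⟨ lemma (c x) (c (x + j)) x j ⟩
    (c x * suc x) * c (x + j) + j * (c x * c (x + j))
      ≡⟨ cong (λ l → l * c (x + j) + j * (c x * c (x + j)))
           (c-inverse (≤-<-trans (m≤m+n x j) x+j<N)) ⟩
    L * c (x + j) + j * (c x * c (x + j))     ∎
    where
    open ≡-Reasoning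
    lemma : ∀ a b x j → b * suc (x + j) * a ≡ a * suc x * b + j * (a * b)
    lemma = solve-∀

  c-gap-suc : ∀ x → suc x < N → L * c x ≡ L * c (suc x) + c x * c (suc x)
  c-gap-suc x x<N =
    subst (λ y → L * c x ≡ L * c y + c x * c y) (+-comm x 1)
      (trans (c-gap x 1 (subst (_< N) (+-comm 1 x) x<N))
        (cong (L * c (x + 1) +_) (*-identityˡ _)))

  -- By `c-gap-suc` the unit decrement of `c` at `x` is proportional to `c x * c (suc x)`, which is
  -- antitone in `x`.
  c-convex : ∀ {x y} → x ≤ y → suc y < N → c (suc x) + c y ≤ c x + c (suc y)
  c-convex {x} {y} x≤y y<N = *-cancelˡ-≤ L (begin
    L * (c (suc x) + c y)
      ≡⟨ *-distribˡ-+ L _ _ ⟩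
    L * c (suc x) + L * c y
      ≡⟨ cong (L * c (suc x) +_) (c-gap-suc y y<N) ⟩
    L * c (suc x) + (L * c (suc y) + c y * c (suc y))
      ≤⟨ +-monoʳ-≤ (L * c (suc x)) (+-monoʳ-≤ (L * c (suc y))
           (*-mono-≤ (c-antitone x≤y) (c-antitone (s≤s x≤y)))) ⟩
    L * c (suc x) + (L * c (suc y) + c x * c (suc x))
      ≡⟨ lemma (L * c (suc x)) (L * c (suc y)) (c x * c (suc x)) ⟩
    (L * c (suc x) + c x * c (suc x)) + L * c (suc y)
      ≡⟨ cong (_+ L * c (suc y)) (c-gap-suc x (≤-<-trans (s≤s x≤y) y<N)) ⟨
    L * c x + L * c (suc y)
      ≡⟨ *-distribˡ-+ L _ _ ⟨
    L * (c x + c (suc y)) ∎)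
    where
    open ≤-Reasoning
    lemma : ∀ a b d → a + (b + d) ≡ (a + d) + b
    lemma = solve-∀

  -- When all δ = j edges at w are moved, the isolated vertex w alone pays for
  -- the move: 1 / (D + j + 1) + 1 / (D + 2) < 1 as soon as D and j are positive.
  slopes-isolating : ∀ {j D} → 0 < j → j ≤ D → D + j < N →
    c D * c (D + j) + c D * c (suc D) < c 0 * c j
  slopes-isolating {j} {D} 0<j j≤D D+j<N = begin-strict
    c D * c (D + j) + c D * c (suc D)
      ≤⟨ +-mono-≤ (*-monoʳ-≤ (c D) (c-antitone (+-mono-≤ 0<D 0<j)))
                  (*-monoʳ-≤ (c D) (c-antitone (s≤s 0<D))) ⟩
    c D * c 2 + c D * c 2            ≡⟨ lemma (c D) (c 2) ⟩
    c D * (c 2 * 2)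
      <⟨ *-monoʳ-< (c D) {{>-nonZero (c-positive D<N)}}
           (*-monoʳ-< (c 2) {{>-nonZero (c-positive 2<N)}} (n<1+n 2)) ⟩
    c D * (c 2 * 3)                  ≡⟨ cong (c D *_) (c-inverse 2<N) ⟩
    c D * L                          ≡⟨ cong (c D *_) (trans (sym (*-identityʳ (c 0))) (c-inverse 0<N)) ⟨
    c D * c 0                        ≡⟨ *-comm (c D) (c 0) ⟩
    c 0 * c D                        ≤⟨ *-monoʳ-≤ (c 0) (c-antitone j≤D) ⟩
    c 0 * c j                        ∎
    where
    open ≤-Reasoning
    0<D = ≤-trans 0<j j≤D
    D<N = ≤-<-trans (m≤m+n D j) D+j<N
    2<N = ≤-<-trans (+-mono-≤ 0<D 0<j) D+j<N
    0<N = ≤-<-trans z≤n 2<N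
    lemma : ∀ a b → a * b + a * b ≡ a * (b * 2)
    lemma = solve-∀

  -- With D = E + j and F = D + j, expand c D up to c (F + 1) and c E up to
  -- c (D + 1); what remains to compare is c F c (F + 1) < c E c (D + 1).
  slopes-filling : ∀ E {j} → 0 < j → suc (E + j + j) < N →
    c (E + j) * c (E + j + j) + c (E + j) * c (suc (E + j)) <
    c E * c (E + j) + c (E + j + j) * c (suc (E + j + j))
  slopes-filling E {j} 0<j F<N = *-cancelˡ-< L _ _ (begin-strict
    L * (c D * c F + c D * c (suc D))
      ≡⟨ l₁ L (c D) (c F) (c (suc D)) ⟩
    L * c D * c F + L * c D * c (suc D)
      ≡⟨ cong (λ t → t * c F + L * c D * c (suc D)) gapD ⟩
    (L * c (suc F) + suc j * (c D * c (suc F))) * c F + L * c D * c (suc D)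
      ≡⟨ l₂ L (c (suc F)) (c D) (c F) (c (suc D)) (suc j) ⟩
    (L * (c F * c (suc F)) + L * c D * c (suc D)) + suc j * c D * (c F * c (suc F))
      <⟨ +-monoʳ-< (L * (c F * c (suc F)) + L * c D * c (suc D))
           (*-monoʳ-< (suc j * c D) {{>-nonZero 0<jcD}}
             (<-≤-trans
               (*-monoˡ-< (c (suc F)) {{>-nonZero (c-positive F<N)}}
                 (c-strict E<F (<-trans (n<1+n F) F<N)))
               (*-monoʳ-≤ (c E) (c-antitone (s≤s D≤F))))) ⟩
    (L * (c F * c (suc F)) + L * c D * c (suc D)) + suc j * c D * (c E * c (suc D))
      ≡⟨ l₃ L (c F) (c (suc F)) (c D) (c (suc D)) (suc j) (c E) ⟩
    (L * c (suc D) + suc j * (c E * c (suc D))) * c D + L * (c F * c (suc F))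
      ≡⟨ cong (λ t → t * c D + L * (c F * c (suc F))) gapE ⟨
    L * c E * c D + L * (c F * c (suc F))
      ≡⟨ l₄ L (c E) (c D) (c F * c (suc F)) ⟩
    L * (c E * c D + c F * c (suc F)) ∎)
    where
    open ≤-Reasoning
    D = E + j
    F = E + j + j
    D≤F : D ≤ F
    D≤F = m≤m+n D j
    E<F : E < F
    E<F = <-≤-trans (m<m+n E 0<j) D≤F
    0<jcD : 0 < suc j * c D
    0<jcD = *-mono-≤ {1} {suc j} (s≤s z≤n) (c-positive (≤-<-trans D≤F (<-trans (n<1+n F) F<N)))
    gapD : L * c D ≡ L * c (suc F) + suc j * (c D * c (suc F))
    gapD = subst (λ y → L * c D ≡ L * c y + suc j * (c D * c y)) (+-suc D j)
             (c-gap D (suc j) (subst (_< N) (sym (+-suc D j)) F<N))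
    gapE : L * c E ≡ L * c (suc D) + suc j * (c E * c (suc D))
    gapE = subst (λ y → L * c E ≡ L * c y + suc j * (c E * c y)) (+-suc E j)
             (c-gap E (suc j) (subst (_< N) (sym (+-suc E j)) (≤-<-trans (s≤s D≤F) F<N)))
    l₁ : ∀ l d f s → l * (d * f + d * s) ≡ l * d * f + l * d * s
    l₁ = solve-∀
    l₂ : ∀ l g d f s k → (l * g + k * (d * g)) * f + l * d * s ≡
                         (l * (f * g) + l * d * s) + k * d * (f * g)
    l₂ = solve-∀
    l₃ : ∀ l f g d s k e → (l * (f * g) + l * d * s) + k * d * (e * s) ≡
                           (l * s + k * (e * s)) * d + l * (f * g)
    l₃ = solve-∀
    l₄ : ∀ l e d x → l * e * d + l * x ≡ l * (e * d + x)
    l₄ = solve-∀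

  slopes : ∀ {δ D j p} → 0 < j → j ≤ δ → δ ≤ D → D + j ≤ suc p → suc p < N →
    j ≡ δ ⊎ p ≤ D + j → suc (D + j) < N →
    c D * c (D + j) + c D * c (suc D) < c (δ ∸ j) * c δ + c p * c (suc p)
  slopes {δ} {D} {j} {p} 0<j j≤δ δ≤D D+j≤P P<N (inj₁ refl) D+j<N = begin-strict
    c D * c (D + j) + c D * c (suc D)    <⟨ slopes-isolating 0<j δ≤D (≤-<-trans D+j≤P P<N) ⟩
    c 0 * c j                            ≡⟨ cong (λ x → c x * c j) (n∸n≡0 j) ⟨
    c (j ∸ j) * c j                      ≤⟨ m≤m+n _ _ ⟩
    c (j ∸ j) * c j + c p * c (suc p)    ∎
    where open ≤-Reasoning
  slopes {δ} {D} {j} {p} 0<j j≤δ δ≤D D+j≤P P<N (inj₂ p≤D+j) D+j<N = begin-strict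
    c D * c (D + j) + c D * c (suc D)
      <⟨ subst (λ x → c x * c (x + j) + c x * c (suc x) <
                      c (D ∸ j) * c x + c (x + j) * c (suc (x + j)))
           E+j≡D
           (slopes-filling (D ∸ j) 0<j (subst (λ x → suc (x + j) < N) (sym E+j≡D) D+j<N)) ⟩
    c (D ∸ j) * c D + c (D + j) * c (suc (D + j))
      ≤⟨ +-mono-≤
           (*-mono-≤ (c-antitone (∸-monoˡ-≤ j δ≤D)) (c-antitone δ≤D))
           (*-mono-≤ (c-antitone p≤D+j) (c-antitone (s≤s p≤D+j))) ⟩
    c (δ ∸ j) * c δ + c p * c (suc p)    ∎
    where
    open ≤-Reasoning
    E+j≡D = m∸n+n≡m (≤-trans j≤δ δ≤D)

  -- The bound of the overview cleared of subtractions. `c-gap` turns each of its four differences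
  -- into `j` times a product of two reciprocals; cancelling `j` leaves `slopes`.
  transfer-gain : ∀ {δ D j p} → 0 < j → j ≤ δ → δ ≤ D → D + j ≤ suc p → suc p < N →
    j ≡ δ ⊎ p ≤ D + j → suc (D + j) < N →
    (c δ + c D) + j * (c (suc p) + c D) <
    (c (δ ∸ j) + c (D + j)) + j * (c p + c (suc D))
  transfer-gain {δ} {D} {j} {p} 0<j j≤δ δ≤D D+j≤P P<N alt D+j<N =
    *-cancelˡ-< L _ _ (begin-strict
    L * ((c δ + c D) + j * (c (suc p) + c D))
      ≡⟨ l₁ L (c δ) (c D) j (c (suc p)) ⟩
    L * c δ + L * c D + j * (L * c (suc p) + L * c D)
      ≡⟨ cong₂ (λ a b → L * c δ + a + j * (L * c (suc p) + b))
           (c-gap D j (<-trans (n<1+n _) D+j<N))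
           (c-gap-suc D (≤-<-trans (s≤s (m≤m+n D j)) D+j<N)) ⟩
    L * c δ + (L * c (D + j) + j * (c D * c (D + j)))
      + j * (L * c (suc p) + (L * c (suc D) + c D * c (suc D)))
      ≡⟨ l₂ (L * c δ) (L * c (D + j)) j (c D * c (D + j)) (L * c (suc p)) (L * c (suc D)) _ ⟩
    (L * c δ + L * c (D + j) + j * (L * c (suc p) + L * c (suc D)))
      + j * (c D * c (D + j) + c D * c (suc D))
      <⟨ +-monoʳ-< (L * c δ + L * c (D + j) + j * (L * c (suc p) + L * c (suc D)))
          (*-monoʳ-< j {{>-nonZero 0<j}} (slopes 0<j j≤δ δ≤D D+j≤P P<N alt D+j<N)) ⟩
    (L * c δ + L * c (D + j) + j * (L * c (suc p) + L * c (suc D)))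
      + j * (c (δ ∸ j) * c δ + c p * c (suc p))
      ≡⟨ l₃ (L * c δ) (L * c (D + j)) j (L * c (suc p)) (L * c (suc D)) (c (δ ∸ j) * c δ) _ ⟩
    (L * c δ + j * (c (δ ∸ j) * c δ)) + L * c (D + j)
      + j * ((L * c (suc p) + c p * c (suc p)) + L * c (suc D))
      ≡⟨ cong₂ (λ a b → a + L * c (D + j) + j * (b + L * c (suc D)))
           gapδ (c-gap-suc p P<N) ⟨
    L * c (δ ∸ j) + L * c (D + j) + j * (L * c p + L * c (suc D))
      ≡⟨ l₄ L (c (δ ∸ j)) (c (D + j)) j (c p) (c (suc D)) ⟩
    L * ((c (δ ∸ j) + c (D + j)) + j * (c p + c (suc D))) ∎)
    where
    open ≤-Reasoning
    gapδ : L * c (δ ∸ j) ≡ L * c δ + j * (c (δ ∸ j) * c δ)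
    gapδ = subst (λ y → L * c (δ ∸ j) ≡ L * c y + j * (c (δ ∸ j) * c y)) (m∸n+n≡m j≤δ)
      (c-gap (δ ∸ j) j (subst (_< N) (sym (m∸n+n≡m j≤δ))
        (≤-<-trans (≤-trans δ≤D (≤-trans (m≤m+n D j) D+j≤P)) P<N)))
    l₁ : ∀ l a d j q → l * ((a + d) + j * (q + d)) ≡ l * a + l * d + j * (l * q + l * d)
    l₁ = solve-∀
    l₂ : ∀ a b j x q s y → a + (b + j * x) + j * (q + (s + y)) ≡
                           (a + b + j * (q + s)) + j * (x + y)
    l₂ = solve-∀
    l₃ : ∀ a b j q s x y → (a + b + j * (q + s)) + j * (x + y) ≡
                           (a + j * x) + b + j * ((q + y) + s)
    l₃ = solve-∀
    l₄ : ∀ l a b j p s → l * a + l * b + j * (l * p + l * s) ≡ l * ((a + b) + j * (p + s))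
    l₄ = solve-∀

-- Counting with Boolean predicates

-- Unfolds to the summand of `card`, so that cardinalities are sums of brackets by definition and
-- the lemmas on sums apply to them directly.
⟦_⟧ : Bool → ℕ
⟦ b ⟧ = if b then 1 else 0

sum-mono-≤ : ∀ {n} {f h : Fin n → ℕ} → (∀ i → f i ≤ h i) → sumℕ f ≤ sumℕ h
sum-mono-≤ {zero}  f≤h = z≤n
sum-mono-≤ {suc n} f≤h = ℕ.+-mono-≤ (f≤h zero) (sum-mono-≤ (f≤h ∘ suc))

card-cong : ∀ {n} {p q : Fin n → Bool} → (∀ i → p i ≡ q i) → card p ≡ card q
card-cong p≗q = sum-cong-≗ (cong ⟦_⟧ ∘ p≗q)

card-none : ∀ {n} {p : Fin n → Bool} → (∀ i → p i ≡ false) → card p ≡ 0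
card-none {n} p≡false = trans (card-cong p≡false) (sum-replicate-zero n)

card-all : ∀ {n} {p : Fin n → Bool} → (∀ i → p i ≡ true) → card p ≡ n
card-all {zero}  p≡true = refl
card-all {suc n} p≡true = cong₂ _+_ (cong ⟦_⟧ (p≡true zero)) (card-all (p≡true ∘ suc))

card-positive : ∀ {n} {p : Fin n → Bool} {i} → p i ≡ true → 0 < card p
card-positive {p = p} {zero}  pi rewrite pi = s≤s z≤n
card-positive {p = p} {suc i} pi =
  ℕ.≤-trans (card-positive {p = p ∘ suc} pi) (ℕ.m≤n+m _ ⟦ p zero ⟧)

card-find : ∀ {n} {p : Fin n → Bool} → 0 < card p → ∃ λ i → p i ≡ true
card-find {suc n} {p} 0<p with p zero in eq
... | true  = zero , eq
... | false with i , pi ← card-find {p = p ∘ suc} 0<p = suc i , pi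

card-singleton : ∀ {n} (v : Fin n) → card (λ i → does (i ≟ v)) ≡ 1
card-singleton {suc n} zero    = cong suc (card-none {n} λ _ → refl)
card-singleton {suc n} (suc v) = card-singleton v

card≤ : ∀ {n} (p : Fin n → Bool) → card p ≤ n
card≤ {zero}  p = z≤n
card≤ {suc n} p with p zero
... | true  = s≤s (card≤ (p ∘ suc))
... | false = ℕ.m≤n⇒m≤1+n (card≤ (p ∘ suc))

card-below : ∀ {n a} → a ≤ n → card {n} (λ i → does (toℕ i ℕ.<? a)) ≡ a
card-below {n}     z≤n       = card-none {n} λ _ → refl
card-below {suc n} (s≤s a≤n) = cong suc (card-below a≤n)

subset-of-card : ∀ {n} (p : Fin n → Bool) {j} → j ≤ card p →
  ∃ λ q → (∀ i → q i ≡ true → p i ≡ true) × card {n} q ≡ j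
subset-of-card {zero}  p z≤n = p , (λ ()) , refl
subset-of-card {suc n} p {j} j≤p with p zero in eq | j
... | false | _ with q , q⊆p , ∣q∣ ← subset-of-card (p ∘ suc) j≤p =
      (λ { zero → false ; (suc i) → q i }) , (λ { (suc i) → q⊆p i }) , ∣q∣
... | true | zero  = (λ _ → false) , (λ _ ()) , card-none {suc n} λ _ → refl
... | true | suc j with q , q⊆p , ∣q∣ ← subset-of-card (p ∘ suc) (s≤s⁻¹ j≤p) =
      (λ { zero → true ; (suc i) → q i }) ,
      (λ { zero _ → eq ; (suc i) → q⊆p i }) , cong suc ∣q∣

argmin : ∀ {n} (p : Fin n → Bool) (f : Fin n → ℕ) →
  (∀ i → p i ≡ false) ⊎ ∃ λ w → p w ≡ true × (∀ i → p i ≡ true → f w ≤ f i)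
argmin {zero}  p f = inj₁ λ ()
argmin {suc n} p f with p zero in eq | argmin (p ∘ suc) (f ∘ suc)
... | false | inj₁ none = inj₁ λ { zero → eq ; (suc i) → none i }
... | false | inj₂ (w , pw , min) =
      inj₂ (suc w , pw , λ { zero p0 → contradiction (trans (sym eq) p0) λ ()
                           ; (suc i) → min i })
... | true  | inj₁ none =
      inj₂ (zero , eq , λ { zero _ → ℕ.≤-refl
                          ; (suc i) pi → contradiction (trans (sym (none i)) pi) λ () })
... | true  | inj₂ (w , pw , min) with ℕ.≤-total (f zero) (f (suc w))
...   | inj₁ 0≤w = inj₂ (zero , eq , λ { zero _ → ℕ.≤-refl
                                       ; (suc i) pi → ℕ.≤-trans 0≤w (min i pi) })
...   | inj₂ w≤0 = inj₂ (suc w , pw , λ { zero _ → w≤0 ; (suc i) → min i })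

does⇒ : ∀ {a} {A : Set a} (a? : Dec A) → does a? ≡ true → A
does⇒ (yes a) _ = a

does⇒¬ : ∀ {a} {A : Set a} (a? : Dec A) → does a? ≡ false → ¬ A
does⇒¬ (no ¬a) _ = ¬a

-- Permutations from equal class sizes

-- Vertex `zero` is sent to some `p` with the same label; deleting both takes the same bracket from
-- the two counts for every label, so the hypothesis passes to the remaining vertices.
relabelling : ∀ {n} (ℓ ℓ′ : Fin n → ℕ) →
  (∀ k → card (λ i → does (ℓ i ℕ.≟ k)) ≡ card (λ i → does (ℓ′ i ℕ.≟ k))) →
  Σ (Permutation′ n) λ π → ∀ i → ℓ i ≡ ℓ′ (π ⟨$⟩ʳ i)
relabelling {zero}  ℓ ℓ′ same = Perm.id , λ ()
relabelling {suc n} ℓ ℓ′ same = Perm.insert zero p π , matches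
  where
  hit : ∃ λ p → does (ℓ′ p ℕ.≟ ℓ zero) ≡ true
  hit = card-find (subst (0 <_) (same (ℓ zero))
          (card-positive {p = λ i → does (ℓ i ℕ.≟ ℓ zero)} {zero}
            (dec-true (ℓ zero ℕ.≟ ℓ zero) refl)))
  p = proj₁ hit
  ℓ′p≡ℓ0 : ℓ′ p ≡ ℓ zero
  ℓ′p≡ℓ0 = does⇒ (ℓ′ p ℕ.≟ ℓ zero) (proj₂ hit)
  rest : ∀ k → card (λ i → does (ℓ (suc i) ℕ.≟ k)) ≡
               card (λ i → does (ℓ′ (punchIn p i) ℕ.≟ k))
  rest k = ℕ.+-cancelˡ-≡ ⟦ does (ℓ zero ℕ.≟ k) ⟧ _ _
    (trans (same k)
      (trans (sum-remove {i = p} (λ i → ⟦ does (ℓ′ i ℕ.≟ k) ⟧))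
        (cong (λ l → ⟦ does (l ℕ.≟ k) ⟧ + card (λ i → does (ℓ′ (punchIn p i) ℕ.≟ k)))
          ℓ′p≡ℓ0)))
  rec = relabelling (ℓ ∘ suc) (ℓ′ ∘ punchIn p) rest
  π = proj₁ rec
  matches : ∀ i → ℓ i ≡ ℓ′ (Perm.insert zero p π ⟨$⟩ʳ i)
  matches zero    = sym ℓ′p≡ℓ0
  matches (suc i) = trans (proj₂ rec i)
    (cong ℓ′ (sym (Perm.insert-punchIn zero p π i)))

card-≤-split : ∀ {n} (ℓ : Fin n → ℕ) k →
  card (λ i → does (ℓ i ℕ.<? suc k)) ≡
  card (λ i → does (ℓ i ℕ.<? k)) + card (λ i → does (ℓ i ℕ.≟ k))
card-≤-split ℓ k = trans (sum-cong-≗ split) (∑-distrib-+ (λ i → ⟦ does (ℓ i ℕ.<? k) ⟧) _)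
  where
  split : ∀ i → ⟦ does (ℓ i ℕ.<? suc k) ⟧ ≡ ⟦ does (ℓ i ℕ.<? k) ⟧ + ⟦ does (ℓ i ℕ.≟ k) ⟧
  split i with ℕ.<-cmp (ℓ i) k
  ... | tri< l<k l≢k _
    rewrite dec-true (ℓ i ℕ.<? suc k) (ℕ.m<n⇒m<1+n l<k)
          | dec-true (ℓ i ℕ.<? k) l<k | dec-false (ℓ i ℕ.≟ k) l≢k = refl
  ... | tri≈ l≮k l≡k _
    rewrite dec-true (ℓ i ℕ.<? suc k) (s≤s (ℕ.≤-reflexive l≡k))
          | dec-false (ℓ i ℕ.<? k) l≮k | dec-true (ℓ i ℕ.≟ k) l≡k = refl
  ... | tri> l≮k l≢k k<l
    rewrite dec-false (ℓ i ℕ.<? suc k) (ℕ.<⇒≱ k<l ∘ s≤s⁻¹)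
          | dec-false (ℓ i ℕ.<? k) l≮k | dec-false (ℓ i ℕ.≟ k) l≢k = refl

relabelling-cumulative : ∀ {n} (ℓ ℓ′ : Fin n → ℕ) →
  (∀ k → card (λ i → does (ℓ i ℕ.<? k)) ≡ card (λ i → does (ℓ′ i ℕ.<? k))) →
  Σ (Permutation′ n) λ π → ∀ i → ℓ i ≡ ℓ′ (π ⟨$⟩ʳ i)
relabelling-cumulative ℓ ℓ′ same = relabelling ℓ ℓ′ λ k →
  ℕ.+-cancelˡ-≡ (card (λ i → does (ℓ i ℕ.<? k))) _ _
    (trans (sym (card-≤-split ℓ k))
      (trans (same (suc k))
        (trans (card-≤-split ℓ′ k)
          (cong (_+ card (λ i → does (ℓ′ i ℕ.≟ k))) (sym (same k))))))

-- Edge counts and degree sums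

-- Counting at the larger end suits quasi-complete graphs: vertex `i` of the clique has exactly `i`
-- smaller neighbours, vertex `q` has `r`, and later vertices have none.
edgeCount-larger-end : ∀ {n} (G : Graph n) →
  edgeCount G ≡ sumℕ λ i → card λ j → does (j <? i) ∧ adj G i j
edgeCount-larger-end G = trans
  (∑-comm λ i j → ⟦ does (i <? j) ∧ adj G i j ⟧)
  (sum-cong-≗ λ i → card-cong λ j → cong (does (j <? i) ∧_) (adj-sym G j i))

handshake : ∀ {n} (G : Graph n) → sumℕ (degree G) ≡ edgeCount G + edgeCount G
handshake {n} G = begin
  sumℕ (degree G)
    ≡⟨ sum-cong-≗ (λ i → trans (sum-cong-≗ (split i)) (∑-distrib-+ (larger i) (smaller i))) ⟩
  sumℕ (λ i → sumℕ (larger i) + sumℕ (smaller i))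
    ≡⟨ ∑-distrib-+ (sumℕ ∘ larger) (sumℕ ∘ smaller) ⟩
  edgeCount G + sumℕ (sumℕ ∘ smaller)
    ≡⟨ cong (edgeCount G +_) (edgeCount-larger-end G) ⟨
  edgeCount G + edgeCount G ∎
  where
  open ≡-Reasoning
  larger smaller : Fin n → Fin n → ℕ
  larger  i j = ⟦ does (i <? j) ∧ adj G i j ⟧
  smaller i j = ⟦ does (j <? i) ∧ adj G i j ⟧
  split : ∀ i j → ⟦ adj G i j ⟧ ≡ larger i j + smaller i j
  split i j with <-cmp i j
  ... | tri< i<j _ j≮i rewrite dec-true (i <? j) i<j | dec-false (j <? i) j≮i =
        sym (ℕ.+-identityʳ _)
  ... | tri≈ i≮i refl _ rewrite dec-false (i <? i) i≮i | adj-irrefl G i = refl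
  ... | tri> i≮j _ j<i rewrite dec-false (i <? j) i≮j | dec-true (j <? i) j<i = refl

-- `edgeCount` refers to the order of the vertices, the degree sum does not. Going through the
-- latter avoids following smaller ends under transfers and permutations.
edgeCount-from-degrees : ∀ {n} (G H : Graph n) →
  sumℕ (degree G) ≡ sumℕ (degree H) → edgeCount G ≡ edgeCount H
edgeCount-from-degrees G H eq = begin
  edgeCount G                          ≡⟨ ℕ.n≡⌊n+n/2⌋ (edgeCount G) ⟩
  ⌊ edgeCount G + edgeCount G /2⌋      ≡⟨ cong ⌊_/2⌋ (trans (sym (handshake G)) (trans eq (handshake H))) ⟩
  ⌊ edgeCount H + edgeCount H /2⌋      ≡⟨ ℕ.n≡⌊n+n/2⌋ (edgeCount H) ⟨
  edgeCount H                          ∎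
  where open ≡-Reasoning

-- Replacing one star by another

star : ∀ {n} → Fin n → (Fin n → Bool) → Fin n → Fin n → Bool
star v S x y = (does (x ≟ v) ∧ S y) ∨ (does (y ≟ v) ∧ S x)

star-elim : ∀ {n} {v : Fin n} {S : Fin n → Bool} {ℓ} {P : Fin n → Fin n → Set ℓ} →
  (∀ {y} → S y ≡ true → P v y) → (∀ {x} → S x ≡ true → P x v) →
  ∀ x y → star v S x y ≡ true → P x y
star-elim {v = v} {S} from to x y xy with x ≟ v | S y in Sy | y ≟ v
... | yes refl | true  | _        = from Sy
... | yes refl | false | yes refl = to xy
... | no _     | _     | yes refl = to xy

-- With the centre outside `S` the two disjuncts of `star` never hold together, so the bracket of
-- the disjunction is the sum of the brackets.
card-star : ∀ {n} {v : Fin n} {S : Fin n → Bool} → S v ≡ false → ∀ x →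
  card (star v S x) ≡ ⟦ does (x ≟ v) ⟧ * card S + ⟦ S x ⟧
card-star {v = v} {S} v∉S x = begin
  card (star v S x)
    ≡⟨ sum-cong-≗ split ⟩
  sumℕ (λ y → ⟦ S y ⟧ * ⟦ does (x ≟ v) ⟧ + ⟦ does (y ≟ v) ⟧ * ⟦ S x ⟧)
    ≡⟨ ∑-distrib-+ (λ y → ⟦ S y ⟧ * ⟦ does (x ≟ v) ⟧) _ ⟩
  sumℕ (λ y → ⟦ S y ⟧ * ⟦ does (x ≟ v) ⟧) + sumℕ (λ y → ⟦ does (y ≟ v) ⟧ * ⟦ S x ⟧)
    ≡⟨ cong₂ _+_ (*-distribʳ-sum ⟦ does (x ≟ v) ⟧ (⟦_⟧ ∘ S))
                 (*-distribʳ-sum ⟦ S x ⟧ λ y → ⟦ does (y ≟ v) ⟧) ⟨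
  card S * ⟦ does (x ≟ v) ⟧ + card (λ y → does (y ≟ v)) * ⟦ S x ⟧
    ≡⟨ cong₂ _+_ (ℕ.*-comm (card S) _)
         (trans (cong (_* ⟦ S x ⟧) (card-singleton v)) (ℕ.*-identityˡ _)) ⟩
  ⟦ does (x ≟ v) ⟧ * card S + ⟦ S x ⟧ ∎
  where
  open ≡-Reasoning
  split : ∀ y → ⟦ star v S x y ⟧ ≡ ⟦ S y ⟧ * ⟦ does (x ≟ v) ⟧ + ⟦ does (y ≟ v) ⟧ * ⟦ S x ⟧
  split y with x ≟ v | y ≟ v
  ... | yes refl | yes refl rewrite v∉S = refl
  ... | yes refl | no _ with S y
  ...   | true  = refl
  ...   | false = refl
  split y | no _ | yes refl rewrite v∉S = sym (ℕ.*-identityˡ _)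
  split y | no _ | no _ rewrite ℕ.*-zeroʳ ⟦ S y ⟧ = refl

∑-indicator : ∀ {n} (v : Fin n) a → sumℕ (λ x → ⟦ does (x ≟ v) ⟧ * a) ≡ a
∑-indicator v a = trans (sym (*-distribʳ-sum a λ x → ⟦ does (x ≟ v) ⟧))
  (trans (cong (_* a) (card-singleton v)) (ℕ.*-identityˡ a))

-- Deleted pairs are edges and new pairs are non-edges, so no pair is both and the count is exact.
-- Losses are added on the left, here and in `degree-transfer`, so that no truncated subtraction
-- occurs.
exchange : ∀ a r s → (r ≡ true → a ≡ true) → (s ≡ true → a ≡ false) →
  ⟦ (a ∧ not r) ∨ s ⟧ + ⟦ r ⟧ ≡ ⟦ a ⟧ + ⟦ s ⟧
exchange true  true  false _ _ = refl
exchange true  false false _ _ = refl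
exchange false false true  _ _ = refl
exchange false false false _ _ = refl
exchange false true  _ r⇒a _ = contradiction (r⇒a refl) λ ()
exchange true  _ true  _ s⇒¬a = contradiction (s⇒¬a refl) λ ()

-- The edges from w to A are replaced by edges from w′ to B. The case w′ ∈ A,
-- in which the edge between w and w′ itself disappears, is not excluded.
module Transfer {n} (G : Graph n) {w w′ : Fin n} {A B : Fin n → Bool}
  (A⊆N : ∀ {i} → A i ≡ true → adj G w i ≡ true)
  (B⊆N̅ : ∀ {i} → B i ≡ true → adj G w′ i ≡ false)
  (w′∉B : B w′ ≡ false) where

  w∉A : A w ≡ false
  w∉A with A w in Aw
  ... | false = refl
  ... | true  = trans (sym (A⊆N Aw)) (adj-irrefl G w)

  transfer : Graph n
  transfer .adj x y = (adj G x y ∧ not (star w A x y)) ∨ star w′ B x y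
  transfer .adj-sym x y = cong₂ _∨_
    (cong₂ (λ a r → a ∧ not r) (adj-sym G x y) (∨-comm (does (x ≟ w) ∧ A y) _))
    (∨-comm (does (x ≟ w′) ∧ B y) _)
  transfer .adj-irrefl x rewrite adj-irrefl G x with x ≟ w′
  ... | yes refl rewrite w′∉B = refl
  ... | no _     = refl

  degree-transfer : ∀ x →
    degree transfer x + (⟦ does (x ≟ w) ⟧ * card A + ⟦ A x ⟧) ≡
    degree G x + (⟦ does (x ≟ w′) ⟧ * card B + ⟦ B x ⟧)
  degree-transfer x = begin
    degree transfer x + (⟦ does (x ≟ w) ⟧ * card A + ⟦ A x ⟧)
      ≡⟨ cong (degree transfer x +_) (card-star w∉A x) ⟨
    degree transfer x + card (star w A x)
      ≡⟨ ∑-distrib-+ (λ y → ⟦ adj transfer x y ⟧) _ ⟨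
    sumℕ (λ y → ⟦ adj transfer x y ⟧ + ⟦ star w A x y ⟧)
      ≡⟨ sum-cong-≗ (λ y → exchange (adj G x y) (star w A x y) (star w′ B x y)
           (star-elim {P = λ x y → adj G x y ≡ true}
             A⊆N (λ {x} Ax → trans (adj-sym G x w) (A⊆N Ax)) x y)
           (star-elim {P = λ x y → adj G x y ≡ false}
             B⊆N̅ (λ {x} Bx → trans (adj-sym G x w′) (B⊆N̅ Bx)) x y)) ⟩
    sumℕ (λ y → ⟦ adj G x y ⟧ + ⟦ star w′ B x y ⟧)
      ≡⟨ ∑-distrib-+ (λ y → ⟦ adj G x y ⟧) _ ⟩
    degree G x + card (star w′ B x)
      ≡⟨ cong (degree G x +_) (card-star w′∉B x) ⟩
    degree G x + (⟦ does (x ≟ w′) ⟧ * card B + ⟦ B x ⟧) ∎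
    where open ≡-Reasoning

  edgeCount-transfer : card A ≡ card B → edgeCount transfer ≡ edgeCount G
  edgeCount-transfer ∣A∣≡∣B∣ = edgeCount-from-degrees transfer G
    (ℕ.+-cancelʳ-≡ (card A + card A) _ _ (begin
      sumℕ (degree transfer) + (card A + card A)
        ≡⟨ cong (sumℕ (degree transfer) +_) (total w A) ⟨
      sumℕ (degree transfer) + sumℕ (λ x → ⟦ does (x ≟ w) ⟧ * card A + ⟦ A x ⟧)
        ≡⟨ ∑-distrib-+ (degree transfer) _ ⟨
      sumℕ (λ x → degree transfer x + (⟦ does (x ≟ w) ⟧ * card A + ⟦ A x ⟧))
        ≡⟨ sum-cong-≗ degree-transfer ⟩
      sumℕ (λ x → degree G x + (⟦ does (x ≟ w′) ⟧ * card B + ⟦ B x ⟧))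
        ≡⟨ ∑-distrib-+ (degree G) _ ⟩
      sumℕ (degree G) + sumℕ (λ x → ⟦ does (x ≟ w′) ⟧ * card B + ⟦ B x ⟧)
        ≡⟨ cong (sumℕ (degree G) +_) (total w′ B) ⟩
      sumℕ (degree G) + (card B + card B)
        ≡⟨ cong (λ k → sumℕ (degree G) + (k + k)) ∣A∣≡∣B∣ ⟨
      sumℕ (degree G) + (card A + card A) ∎))
    where
    open ≡-Reasoning
    total : ∀ v S → sumℕ (λ x → ⟦ does (x ≟ v) ⟧ * card S + ⟦ S x ⟧) ≡ card S + card S
    total v S = trans (∑-distrib-+ (λ x → ⟦ does (x ≟ v) ⟧ * card S) _)
      (cong (_+ card S) (∑-indicator v (card S)))

-- The effect of a transfer on the sum of reciprocals

module Weight (N : ℕ) where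
  open Reciprocals N

  -- The change at a single vertex of degree d, where isW, isW′, a and b tell
  -- whether it is w, is w′, lies in A and lies in B; all terms are moved to
  -- the side on which they are positive.
  shift-bound : ∀ {δ D j p} → suc (suc p) < N → 0 < j → D + j ≤ suc p →
    ∀ {d d′} (isW isW′ a b : Bool) →
    d′ + (⟦ isW ⟧ * j + ⟦ a ⟧) ≡ d + (⟦ isW′ ⟧ * j + ⟦ b ⟧) →
    d ≤ suc p →
    (isW ≡ true → d ≡ δ × isW′ ≡ false × a ≡ false × b ≡ false) →
    (isW′ ≡ true → d ≡ D × b ≡ false) →
    (b ≡ true → D ≤ d) →
    c d + ((⟦ isW ⟧ * c (δ ∸ j) + ⟦ isW′ ⟧ * c (D + j))
         + (⟦ a ⟧ * c p + ⟦ b ⟧ * c (suc D))) ≤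
    c d′ + ((⟦ isW ⟧ * c δ + ⟦ isW′ ⟧ * c D)
          + (⟦ a ⟧ * c (suc p) + ⟦ b ⟧ * c D))
  shift-bound {δ} {D} {j} {p} P<N 0<j D+j≤P {d} {d′} = bound
    where
    open ℕ.≤-Reasoning
    D≤p : D ≤ p
    D≤p = s≤s⁻¹ (ℕ.≤-trans (ℕ.m<m+n D 0<j) D+j≤P)
    P′<N : suc p < N
    P′<N = ℕ.<-trans (ℕ.n<1+n _) P<N
    bound : ∀ isW isW′ a b →
      d′ + (⟦ isW ⟧ * j + ⟦ a ⟧) ≡ d + (⟦ isW′ ⟧ * j + ⟦ b ⟧) →
      d ≤ suc p →
      (isW ≡ true → d ≡ δ × isW′ ≡ false × a ≡ false × b ≡ false) →
      (isW′ ≡ true → d ≡ D × b ≡ false) →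
      (b ≡ true → D ≤ d) →
      c d + ((⟦ isW ⟧ * c (δ ∸ j) + ⟦ isW′ ⟧ * c (D + j))
           + (⟦ a ⟧ * c p + ⟦ b ⟧ * c (suc D))) ≤
      c d′ + ((⟦ isW ⟧ * c δ + ⟦ isW′ ⟧ * c D)
            + (⟦ a ⟧ * c (suc p) + ⟦ b ⟧ * c D))
    bound true isW′ a b eq _ atW _ _ with refl , refl , refl , refl ← atW refl = begin
      c d + ((1 * c (d ∸ j) + 0) + 0)  ≡⟨ swap (c d) (c (d ∸ j)) ⟩
      c (d ∸ j) + ((1 * c d + 0) + 0)  ≡⟨ cong (λ x → c x + ((1 * c d + 0) + 0)) d∸j≡d′ ⟩
      c d′ + ((1 * c d + 0) + 0)       ∎
      where
      swap : ∀ x y → x + ((1 * y + 0) + 0) ≡ y + ((1 * x + 0) + 0)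
      swap = solve-∀
      unfold : ∀ x y → x + (1 * y + 0) ≡ x + y
      unfold = solve-∀
      d∸j≡d′ : d ∸ j ≡ d′
      d∸j≡d′ = begin-equality
        d ∸ j                   ≡⟨ cong (_∸ j) (ℕ.+-identityʳ d) ⟨
        d + 0 ∸ j               ≡⟨ cong (_∸ j) eq ⟨
        d′ + (1 * j + 0) ∸ j    ≡⟨ cong (_∸ j) (unfold d′ j) ⟩
        d′ + j ∸ j              ≡⟨ ℕ.m+n∸n≡m d′ j ⟩
        d′                      ∎
    bound false true false b eq _ _ atW′ _ with refl , refl ← atW′ refl = begin
      c d + (1 * c (d + j) + 0)  ≡⟨ swap (c d) (c (d + j)) ⟩
      c (d + j) + (1 * c d + 0)  ≡⟨ cong (λ x → c x + (1 * c d + 0)) d+j≡d′ ⟩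
      c d′ + (1 * c d + 0)       ∎
      where
      swap : ∀ x y → x + (1 * y + 0) ≡ y + (1 * x + 0)
      swap = solve-∀
      unfold : ∀ x y → x + y ≡ x + (1 * y + 0)
      unfold = solve-∀
      d+j≡d′ : d + j ≡ d′
      d+j≡d′ = trans (unfold d j) (trans (sym eq) (ℕ.+-identityʳ d′))
    -- Here w′ loses its edge to w, so its degree rises only to `D + j` less one. Convexity applies
    -- because `D + j ≤ suc p`.
    bound false true true b eq _ _ atW′ _ with refl , refl ← atW′ refl = begin
      c d + (1 * c (d + j) + (1 * c p + 0))
        ≡⟨ cong (λ x → c d + (1 * c x + (1 * c p + 0))) d+j≡1+d′ ⟩
      c d + (1 * c (suc d′) + (1 * c p + 0))
        ≡⟨ split (c d) (c (suc d′)) (c p) ⟩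
      c d + (c (suc d′) + c p)
        ≤⟨ ℕ.+-monoʳ-≤ (c d) (c-convex
             (s≤s⁻¹ (ℕ.≤-trans (ℕ.≤-reflexive (sym d+j≡1+d′)) D+j≤P)) P′<N) ⟩
      c d + (c d′ + c (suc p))
        ≡⟨ join (c d) (c d′) (c (suc p)) ⟩
      c d′ + (1 * c d + (1 * c (suc p) + 0)) ∎
      where
      split : ∀ x y z → x + (1 * y + (1 * z + 0)) ≡ x + (y + z)
      split = solve-∀
      join : ∀ x y z → x + (y + z) ≡ y + (1 * x + (1 * z + 0))
      join = solve-∀
      unfold : ∀ x y → x + y ≡ x + (1 * y + 0)
      unfold = solve-∀
      d+j≡1+d′ : d + j ≡ suc d′
      d+j≡1+d′ = trans (unfold d j) (trans (sym eq) (ℕ.+-comm d′ 1))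
    -- The old degree is at most `suc p`, so by convexity losing an edge gains at least `c p` minus
    -- `c (suc p)`.
    bound false false true false eq d≤P _ _ _ = begin
      c d + (1 * c p + 0)          ≡⟨ cong (λ x → c x + (1 * c p + 0)) d≡1+d′ ⟩
      c (suc d′) + (1 * c p + 0)   ≡⟨ tidy (c (suc d′)) (c p) ⟩
      c (suc d′) + c p
        ≤⟨ c-convex (s≤s⁻¹ (ℕ.≤-trans (ℕ.≤-reflexive (sym d≡1+d′)) d≤P)) P′<N ⟩
      c d′ + c (suc p)             ≡⟨ tidy (c d′) (c (suc p)) ⟨
      c d′ + (1 * c (suc p) + 0)   ∎
      where
      tidy : ∀ x y → x + (1 * y + 0) ≡ x + y
      tidy = solve-∀
      d≡1+d′ : d ≡ suc d′
      d≡1+d′ = trans (sym (ℕ.+-identityʳ d)) (trans (sym eq) (ℕ.+-comm d′ 1))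
    bound false false false true eq d≤P _ _ atB = begin
      c d + 1 * c (suc D)    ≡⟨ tidy (c d) (c (suc D)) ⟩
      c (suc D) + c d        ≤⟨ c-convex (atB refl) (ℕ.≤-<-trans (s≤s d≤P) P<N) ⟩
      c D + c (suc d)        ≡⟨ tidy (c (suc d)) (c D) ⟨
      c (suc d) + 1 * c D    ≡⟨ cong (λ x → c x + 1 * c D) 1+d≡d′ ⟩
      c d′ + 1 * c D         ∎
      where
      tidy : ∀ x y → x + 1 * y ≡ y + x
      tidy = solve-∀
      1+d≡d′ : suc d ≡ d′
      1+d≡d′ = trans (ℕ.+-comm 1 d) (trans (sym eq) (ℕ.+-identityʳ d′))
    -- The degree is unchanged, while the accounting charges a cost at `D` against a gain at `p`;
    -- since `D ≤ p`, the cost is at least the gain.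
    bound false false true true eq _ _ _ _ = begin
      c d + (1 * c p + 1 * c (suc D))
        ≡⟨ cong (λ x → c x + (1 * c p + 1 * c (suc D))) (ℕ.+-cancelʳ-≡ 1 d′ d eq) ⟨
      c d′ + (1 * c p + 1 * c (suc D))
        ≡⟨ tidy (c d′) (c p) (c (suc D)) ⟩
      c d′ + (c (suc D) + c p)
        ≤⟨ ℕ.+-monoʳ-≤ (c d′) (c-convex D≤p P′<N) ⟩
      c d′ + (c D + c (suc p))
        ≡⟨ tidy (c d′) (c (suc p)) (c D) ⟨
      c d′ + (1 * c (suc p) + 1 * c D) ∎
      where
      tidy : ∀ x y z → x + (1 * y + 1 * z) ≡ x + (z + y)
      tidy = solve-∀
    bound false false false false eq _ _ _ _ =
      ℕ.≤-reflexive (cong (λ x → c x + 0) (sym (ℕ.+-cancelʳ-≡ 0 d′ d eq)))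

  W : ∀ {n} → Graph n → ℕ
  W G = sumℕ (c ∘ degree G)

  ∑-weights : ∀ {n} {w w′ : Fin n} {A B : Fin n → Bool} →
    card A ≡ card B → ∀ (f : Fin n → ℕ) x y z t →
    sumℕ (λ i → f i + ((⟦ does (i ≟ w) ⟧ * x + ⟦ does (i ≟ w′) ⟧ * y)
                     + (⟦ A i ⟧ * z + ⟦ B i ⟧ * t))) ≡
    sumℕ f + ((x + y) + card A * (z + t))
  ∑-weights {w = w} {w′} {A} {B} ∣A∣≡∣B∣ f x y z t =
    trans (∑-distrib-+ f _) (cong (sumℕ f +_)
      (trans (∑-distrib-+ (λ i → ⟦ does (i ≟ w) ⟧ * x + ⟦ does (i ≟ w′) ⟧ * y) _)
        (cong₂ _+_
          (trans (∑-distrib-+ (λ i → ⟦ does (i ≟ w) ⟧ * x) _)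
            (cong₂ _+_ (∑-indicator w x) (∑-indicator w′ y)))
          (trans (∑-distrib-+ (λ i → ⟦ A i ⟧ * z) _)
            (trans (cong₂ _+_ (sym (*-distribʳ-sum z (⟦_⟧ ∘ A)))
                      (trans (sym (*-distribʳ-sum t (⟦_⟧ ∘ B)))
                        (cong (_* t) (sym ∣A∣≡∣B∣))))
              (sym (ℕ.*-distribˡ-+ (card A) z t)))))))

  module _ {n} (G : Graph n) {w w′ : Fin n} {A B : Fin n → Bool}
    (A⊆N : ∀ {i} → A i ≡ true → adj G w i ≡ true)
    (B⊆N̅ : ∀ {i} → B i ≡ true → adj G w′ i ≡ false)
    (w′∉B : B w′ ≡ false) where

    open Transfer G {A = A} A⊆N B⊆N̅ w′∉B

    transfer-increases-W : ∀ {p} → suc (suc p) < N →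
      w ≢ w′ → B w ≡ false → card A ≡ card B → 0 < card A →
      degree G w ≤ degree G w′ →
      (∀ i → degree G i ≤ suc p) →
      (∀ {i} → B i ≡ true → degree G w′ ≤ degree G i) →
      degree G w′ + card A ≤ suc p →
      card A ≡ degree G w ⊎ p ≤ degree G w′ + card A →
      W G < W transfer
    transfer-increases-W {p} P<N w≢w′ w∉B ∣A∣≡∣B∣ 0<j δ≤D d≤P D≤d D+j≤P alt =
      -- `T′` and `T` are the totals of the correction terms on the two sides of `shift-bound`.
      -- Adding them instead of subtracting turns the pointwise bounds into a comparison of sums,
      -- after which `T` cancels.
      ℕ.+-cancelʳ-< T _ _ (begin-strict
        W G + T            <⟨ ℕ.+-monoʳ-< (W G) (transfer-gain 0<j j≤δ δ≤D D+j≤P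
                                (ℕ.<-trans (ℕ.n<1+n _) P<N) alt
                                (ℕ.≤-<-trans (s≤s D+j≤P) P<N)) ⟩
        W G + T′           ≡⟨ ∑-weights {w = w} {w′} {A} {B} ∣A∣≡∣B∣ (c ∘ degree G)
                                (c (δ ∸ j)) (c (D + j)) (c p) (c (suc D)) ⟨
        sumℕ before        ≤⟨ sum-mono-≤ pointwise ⟩
        sumℕ after         ≡⟨ ∑-weights {w = w} {w′} {A} {B} ∣A∣≡∣B∣ (c ∘ degree transfer)
                                (c δ) (c D) (c (suc p)) (c D) ⟩
        W transfer + T     ∎)
      where
      open ℕ.≤-Reasoning
      δ = degree G w
      D = degree G w′
      j = card A
      T  = (c δ + c D) + j * (c (suc p) + c D)
      T′ = (c (δ ∸ j) + c (D + j)) + j * (c p + c (suc D))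
      j≤δ : j ≤ δ
      j≤δ = sum-mono-≤ λ i → go i
        where
        go : ∀ i → ⟦ A i ⟧ ≤ ⟦ adj G w i ⟧
        go i with A i in Ai
        ... | false = z≤n
        ... | true rewrite A⊆N Ai = s≤s z≤n
      before after : Fin n → ℕ
      before i = c (degree G i) +
        ((⟦ does (i ≟ w) ⟧ * c (δ ∸ j) + ⟦ does (i ≟ w′) ⟧ * c (D + j))
         + (⟦ A i ⟧ * c p + ⟦ B i ⟧ * c (suc D)))
      after i = c (degree transfer i) +
        ((⟦ does (i ≟ w) ⟧ * c δ + ⟦ does (i ≟ w′) ⟧ * c D)
         + (⟦ A i ⟧ * c (suc p) + ⟦ B i ⟧ * c D))
      pointwise : ∀ i → before i ≤ after i
      pointwise i = shift-bound P<N 0<j D+j≤P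
        (does (i ≟ w)) (does (i ≟ w′)) (A i) (B i)
        (subst (λ k → degree transfer i + (⟦ does (i ≟ w) ⟧ * j + ⟦ A i ⟧) ≡
                      degree G i + (⟦ does (i ≟ w′) ⟧ * k + ⟦ B i ⟧))
          (sym ∣A∣≡∣B∣) (degree-transfer i))
        (d≤P i)
        (λ i≟w → at-w (does⇒ (i ≟ w) i≟w))
        (λ i≟w′ → at-w′ (does⇒ (i ≟ w′) i≟w′))
        D≤d
        where
        at-w : i ≡ w → degree G i ≡ δ × does (i ≟ w′) ≡ false × A i ≡ false × B i ≡ false
        at-w refl = refl , dec-false (i ≟ w′) w≢w′ , w∉A , w∉B
        at-w′ : i ≡ w′ → degree G i ≡ D × B i ≡ false
        at-w′ refl = refl , w′∉B

-- Edge counts of quasi-complete graphs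

-- Freeing the parameters from `decompose` also admits `r ≡ q`, the case in which the extra vertex
-- sees the whole clique.
quasiComplete : ∀ n (q r : ℕ) → Graph n
quasiComplete n q r .adj i j = does (QKAdj? q r (toℕ i) (toℕ j))
quasiComplete n q r .adj-sym i j = does-⇔ (mk⇔ QKAdj-sym QKAdj-sym)
  (QKAdj? q r (toℕ i) (toℕ j)) (QKAdj? q r (toℕ j) (toℕ i))
quasiComplete n q r .adj-irrefl i =
  dec-false (QKAdj? q r (toℕ i) (toℕ i)) λ (i≢i , _) → i≢i refl

smaller-neighbours : (q r i : ℕ) → ℕ
smaller-neighbours q r i =
  if does (i ℕ.<? q) then i else if does (i ℕ.≟ q) then r else 0

smaller-neighbours-< : ∀ {q r i} → i < q → smaller-neighbours q r i ≡ i
smaller-neighbours-< {q} {r} {i} i<q rewrite dec-true (i ℕ.<? q) i<q = refl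

smaller-neighbours-≡ : ∀ q r → smaller-neighbours q r q ≡ r
smaller-neighbours-≡ q r
  rewrite dec-false (q ℕ.<? q) (ℕ.<-irrefl refl) | dec-true (q ℕ.≟ q) refl = refl

smaller-neighbours-> : ∀ {q r i} → q < i → smaller-neighbours q r i ≡ 0
smaller-neighbours-> {q} {r} {i} q<i
  rewrite dec-false (i ℕ.<? q) (ℕ.<-asym q<i)
        | dec-false (i ℕ.≟ q) (ℕ.<⇒≢ q<i ∘ sym) = refl

card-smaller-neighbours : ∀ {n q r} → r ≤ q → ∀ (i : Fin n) →
  card (λ j → does (j <? i) ∧ adj (quasiComplete n q r) i j) ≡
  smaller-neighbours q r (toℕ i)
card-smaller-neighbours {n} {q} {r} r≤q i with ℕ.<-cmp (toℕ i) q
... | tri< i<q _ _ =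
      trans (card-cong {n} λ j → does-⇔
              (mk⇔ proj₁ λ j<i → j<i , ℕ.<⇒≢ j<i ∘ sym , inj₁ (i<q , ℕ.<-trans j<i i<q))
              ((j <? i) ×-dec QKAdj? q r (toℕ i) (toℕ j)) (toℕ j ℕ.<? toℕ i))
        (trans (card-below {n} (ℕ.<⇒≤ (toℕ<n i))) (sym (smaller-neighbours-< i<q)))
... | tri≈ i≮q refl _ =
      trans (card-cong {n} λ j → does-⇔ (mk⇔ to λ j<r →
                ℕ.<-≤-trans j<r r≤q , ℕ.<⇒≢ (ℕ.<-≤-trans j<r r≤q) ∘ sym , inj₂ (inj₁ (refl , j<r)))
              ((j <? i) ×-dec QKAdj? (toℕ i) r (toℕ i) (toℕ j)) (toℕ j ℕ.<? r))
        (trans (card-below {n} (ℕ.≤-trans r≤q (ℕ.<⇒≤ (toℕ<n i))))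
          (sym (smaller-neighbours-≡ (toℕ i) r)))
      where
      to : ∀ {j} → j < toℕ i × QKAdj (toℕ i) r (toℕ i) j → j < r
      to (_   , _ , inj₁ (i<i , _))         = contradiction i<i i≮q
      to (_   , _ , inj₂ (inj₁ (_ , j<r)))  = j<r
      to (j<i , _ , inj₂ (inj₂ (j≡i , _)))  = contradiction j≡i (ℕ.<⇒≢ j<i)
... | tri> i≮q i≢q q<i =
      trans (card-none {n} λ j → dec-false ((j <? i) ×-dec QKAdj? q r (toℕ i) (toℕ j)) λ where
        (_ , _ , inj₁ (i<q , _))        → i≮q i<q
        (_ , _ , inj₂ (inj₁ (i≡q , _))) → i≢q i≡q
        (_ , _ , inj₂ (inj₂ (_ , i<r))) → i≮q (ℕ.<-≤-trans i<r r≤q))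
        (sym (smaller-neighbours-> q<i))

sum-toℕ-last : ∀ n (f : ℕ → ℕ) →
  sumℕ {suc n} (f ∘ toℕ) ≡ sumℕ {n} (f ∘ toℕ) + f n
sum-toℕ-last n f = trans (sum-init-last (f ∘ toℕ))
  (cong₂ _+_ (sum-cong-≗ {n} (cong f ∘ toℕ-inject₁)) (cong f (toℕ-fromℕ n)))

sum-smaller-clique : ∀ {n q r} → n ≤ q →
  sumℕ {n} (smaller-neighbours q r ∘ toℕ) ≡ n C 2
sum-smaller-clique {zero}          _   = refl
sum-smaller-clique {suc n} {q} {r} n<q = begin
  sumℕ {suc n} (smaller-neighbours q r ∘ toℕ)
    ≡⟨ sum-toℕ-last n (smaller-neighbours q r) ⟩
  sumℕ {n} (smaller-neighbours q r ∘ toℕ) + smaller-neighbours q r n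
    ≡⟨ cong₂ _+_ (sum-smaller-clique (ℕ.<⇒≤ n<q))
         (smaller-neighbours-< n<q) ⟩
  n C 2 + n
    ≡⟨ [1+q]C2≡qC2+q n ⟨
  suc n C 2 ∎
  where open ≡-Reasoning

sum-smaller : ∀ {n q r} → q < n →
  sumℕ {n} (smaller-neighbours q r ∘ toℕ) ≡ q C 2 + r
sum-smaller {suc n} {q} {r} q<1+n =
  trans (sum-toℕ-last n (smaller-neighbours q r)) (last (ℕ.m<1+n⇒m<n∨m≡n q<1+n))
  where
  last : q < n ⊎ q ≡ n →
    sumℕ {n} (smaller-neighbours q r ∘ toℕ) + smaller-neighbours q r n ≡ q C 2 + r
  last (inj₁ q<n)  =
    trans (cong₂ _+_ (sum-smaller q<n) (smaller-neighbours-> q<n)) (ℕ.+-identityʳ _)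
  last (inj₂ refl) =
    cong₂ _+_ (sum-smaller-clique {n} ℕ.≤-refl) (smaller-neighbours-≡ q r)

edgeCount-quasiComplete : ∀ {n q r} → r ≤ q → q < n ⊎ (q ≡ n × r ≡ 0) →
  edgeCount (quasiComplete n q r) ≡ q C 2 + r
edgeCount-quasiComplete {n} {q} {r} r≤q bound =
  trans (edgeCount-larger-end (quasiComplete n q r))
    (trans (sum-cong-≗ (card-smaller-neighbours {n} {q} r≤q)) (total bound))
  where
  total : q < n ⊎ (q ≡ n × r ≡ 0) →
    sumℕ {n} (smaller-neighbours q r ∘ toℕ) ≡ q C 2 + r
  total (inj₁ q<n)           = sum-smaller q<n
  total (inj₂ (refl , refl)) = trans (sum-smaller-clique {n} ℕ.≤-refl) (sym (ℕ.+-identityʳ _))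

-- Invariance under isomorphism

degree-≅ : ∀ {n} (G H : Graph n) ((π , _) : G ≅ H) → ∀ i →
  degree G i ≡ degree H (π ⟨$⟩ʳ i)
degree-≅ G H (π , iso) i = trans (card-cong (iso i))
  (sym (sum-permute (λ j → ⟦ adj H (π ⟨$⟩ʳ i) j ⟧) π))

∑-degree-≅ : ∀ {n} (G H : Graph n) → G ≅ H → ∀ (f : ℕ → ℕ) →
  sumℕ (f ∘ degree G) ≡ sumℕ (f ∘ degree H)
∑-degree-≅ G H iso@(π , _) f = trans (sum-cong-≗ (cong f ∘ degree-≅ G H iso))
  (sym (sum-permute (f ∘ degree H) π))

edgeCount-≅ : ∀ {n} (G H : Graph n) → G ≅ H → edgeCount G ≡ edgeCount H
edgeCount-≅ G H iso = edgeCount-from-degrees G H (∑-degree-≅ G H iso λ d → d)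

edgeCount-QK : ∀ n m → 0 < n → m ≤ n C 2 → QK n m ∈𝔾 m
edgeCount-QK n m 0<n m≤nC2 =
  trans (edgeCount-quasiComplete (ℕ.<⇒≤ r<q) bound) (sym m≡)
  where
  open Decomposition (decompose m)
  bound : q < n ⊎ (q ≡ n × r ≡ 0)
  bound with ℕ.<-cmp q n
  ... | tri< q<n _ _ = inj₁ q<n
  ... | tri≈ _ refl _ = inj₂ (refl , ℕ.n≤0⇒n≡0 (ℕ.+-cancelˡ-≤ (q C 2) r 0
          (ℕ.≤-trans (ℕ.≤-reflexive (sym m≡))
            (ℕ.≤-trans m≤nC2 (ℕ.≤-reflexive (sym (ℕ.+-identityʳ (q C 2))))))))
  -- As `0 < n`, the pair of `n` and remainder 0 is itself admissible, so a larger `q` would force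
  -- more than `n C 2` edges.
  ... | tri> _ _ n<q = contradiction m≤nC2 (ℕ.<⇒≱ (begin-strict
          n C 2         ≡⟨ ℕ.+-identityʳ (n C 2) ⟨
          n C 2 + 0     <⟨ decomposition-< 0<n n<q ⟩
          q C 2 + r     ≡⟨ m≡ ⟨
          m             ∎))
    where open ℕ.≤-Reasoning

-- Recognizing quasi-complete graphs

-- Codes for the four kinds of vertices: clique vertices joined to the extra vertex, other clique
-- vertices, the extra vertex, isolated vertices. In this order the nested classes are initial
-- segments of the codes, so cumulative counts give their sizes without forming differences.
label : Bool → Bool → Bool → ℕ
label true  _     _     = 0
label false true  _     = 1
label false false true  = 2
label false false false = 3

label<1 : ∀ a b e → does (label a b e ℕ.<? 1) ≡ a
label<1 true  _     _     = refl
label<1 false true  _     = refl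
label<1 false false true  = refl
label<1 false false false = refl

label<2 : ∀ a b e → (a ≡ true → b ≡ true) → does (label a b e ℕ.<? 2) ≡ b
label<2 true  true  _     _   = refl
label<2 true  false _     a⇒b = sym (a⇒b refl)
label<2 false true  _     _   = refl
label<2 false false true  _   = refl
label<2 false false false _   = refl

label≡2 : ∀ a b e → (a ≡ true → b ≡ true) → (b ≡ true → e ≡ false) →
  does (label a b e ℕ.≟ 2) ≡ e
label≡2 true  _     _     a⇒b b⇒¬e = sym (b⇒¬e (a⇒b refl))
label≡2 false true  _     _   b⇒¬e = sym (b⇒¬e refl)
label≡2 false false true  _   _    = refl
label≡2 false false false _   _    = refl

label<4 : ∀ a b e k → does (label a b e ℕ.<? (4 + k)) ≡ true
label<4 true  _     _     _ = refl
label<4 false true  _     _ = refl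
label<4 false false true  _ = refl
label<4 false false false _ = refl

module Labels {n} (a b e : Fin n → Bool)
  (a⊆b : ∀ i → a i ≡ true → b i ≡ true) (b∩e≡∅ : ∀ i → b i ≡ true → e i ≡ false) where

  ℓ : Fin n → ℕ
  ℓ i = label (a i) (b i) (e i)

  ℓ<1 : ∀ i → does (ℓ i ℕ.<? 1) ≡ a i
  ℓ<1 i = label<1 (a i) (b i) (e i)

  ℓ<2 : ∀ i → does (ℓ i ℕ.<? 2) ≡ b i
  ℓ<2 i = label<2 (a i) (b i) (e i) (a⊆b i)

  ℓ≡2 : ∀ i → does (ℓ i ℕ.≟ 2) ≡ e i
  ℓ≡2 i = label≡2 (a i) (b i) (e i) (a⊆b i) (b∩e≡∅ i)

  cumulative : ℕ → ℕ
  cumulative 0 = 0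
  cumulative 1 = card a
  cumulative 2 = card b
  cumulative 3 = card b + card e
  cumulative (suc (suc (suc (suc k)))) = n

  card-ℓ< : ∀ k → card (λ i → does (ℓ i ℕ.<? k)) ≡ cumulative k
  card-ℓ< 0 = card-none {n} λ _ → refl
  card-ℓ< 1 = card-cong ℓ<1
  card-ℓ< 2 = card-cong ℓ<2
  card-ℓ< 3 = trans (card-≤-split ℓ 2) (cong₂ _+_ (card-cong ℓ<2) (card-cong ℓ≡2))
  card-ℓ< (suc (suc (suc (suc k)))) = card-all λ i → label<4 (a i) (b i) (e i) k

matching : ∀ {n} (a b e a′ b′ e′ : Fin n → Bool) →
  (∀ i → a i ≡ true → b i ≡ true) → (∀ i → b i ≡ true → e i ≡ false) →
  (∀ i → a′ i ≡ true → b′ i ≡ true) → (∀ i → b′ i ≡ true → e′ i ≡ false) →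
  card a ≡ card a′ → card b ≡ card b′ → card e ≡ card e′ →
  Σ (Permutation′ n) λ π → ∀ i →
    a i ≡ a′ (π ⟨$⟩ʳ i) × b i ≡ b′ (π ⟨$⟩ʳ i) × e i ≡ e′ (π ⟨$⟩ʳ i)
matching {n} a b e a′ b′ e′ a⊆b b∩e a′⊆b′ b′∩e′ ∣a∣ ∣b∣ ∣e∣ =
  π , λ i →
    trans (sym (L.ℓ<1 i)) (trans (cong (λ l → does (l ℕ.<? 1)) (ℓ≗ i)) (L′.ℓ<1 _)) ,
    trans (sym (L.ℓ<2 i)) (trans (cong (λ l → does (l ℕ.<? 2)) (ℓ≗ i)) (L′.ℓ<2 _)) ,
    trans (sym (L.ℓ≡2 i)) (trans (cong (λ l → does (l ℕ.≟ 2)) (ℓ≗ i)) (L′.ℓ≡2 _))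
  where
  module L  = Labels a b e a⊆b b∩e
  module L′ = Labels a′ b′ e′ a′⊆b′ b′∩e′
  cumulative≗ : ∀ k → L.cumulative k ≡ L′.cumulative k
  cumulative≗ 0 = refl
  cumulative≗ 1 = ∣a∣
  cumulative≗ 2 = ∣b∣
  cumulative≗ 3 = cong₂ _+_ ∣b∣ ∣e∣
  cumulative≗ (suc (suc (suc (suc k)))) = refl
  relabel = relabelling-cumulative L.ℓ L′.ℓ λ k →
    trans (L.card-ℓ< k) (trans (cumulative≗ k) (sym (L′.card-ℓ< k)))
  π  = proj₁ relabel
  ℓ≗ = proj₂ relabel

card-toℕ≟ : ∀ {n q} → q < n → card {n} (λ i → does (toℕ i ℕ.≟ q)) ≡ 1
card-toℕ≟ {n} {q} q<n = ℕ.+-cancelˡ-≡ q _ _ (begin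
  q + ∣q∣                                        ≡⟨ cong (_+ ∣q∣) (card-below {n} (ℕ.<⇒≤ q<n)) ⟨
  card {n} (λ i → does (toℕ i ℕ.<? q)) + ∣q∣     ≡⟨ card-≤-split {n} toℕ q ⟨
  card {n} (λ i → does (toℕ i ℕ.<? suc q))       ≡⟨ card-below {n} q<n ⟩
  suc q                                          ≡⟨ ℕ.+-comm 1 q ⟩
  q + 1                                          ∎)
  where
  open ≡-Reasoning
  ∣q∣ = card {n} (λ i → does (toℕ i ℕ.≟ q))

does-QKAdj-≢ : ∀ q r {i j} → i ≢ j → does (QKAdj? q r i j) ≡
  (does (i ℕ.<? q) ∧ does (j ℕ.<? q)) ∨
  ((does (i ℕ.≟ q) ∧ does (j ℕ.<? r)) ∨ (does (j ℕ.≟ q) ∧ does (i ℕ.<? r)))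
does-QKAdj-≢ q r {i} {j} i≢j =
  cong (λ b → not b ∧ ((does (i ℕ.<? q) ∧ does (j ℕ.<? q)) ∨
    ((does (i ℕ.≟ q) ∧ does (j ℕ.<? r)) ∨ (does (j ℕ.≟ q) ∧ does (i ℕ.<? r)))))
    (dec-false (i ℕ.≟ j) i≢j)

≅-from-shape : ∀ {n} (G : Graph n) q r (π : Permutation′ n) (a b e : Fin n → Bool) →
  (∀ i → a i ≡ does (toℕ (π ⟨$⟩ʳ i) ℕ.<? r) ×
         b i ≡ does (toℕ (π ⟨$⟩ʳ i) ℕ.<? q) ×
         e i ≡ does (toℕ (π ⟨$⟩ʳ i) ℕ.≟ q)) →
  (∀ x y → x ≢ y → adj G x y ≡ (b x ∧ b y) ∨ ((e x ∧ a y) ∨ (e y ∧ a x))) →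
  ∀ x y → adj G x y ≡ adj (quasiComplete n q r) (π ⟨$⟩ʳ x) (π ⟨$⟩ʳ y)
≅-from-shape {n} G q r π a b e matches shape x y with x ≟ y
... | yes refl = trans (adj-irrefl G x)
        (sym (adj-irrefl (quasiComplete n q r) (π ⟨$⟩ʳ x)))
... | no x≢y =
  let ax , bx , ex = matches x
      ay , by , ey = matches y
  in trans (shape x y x≢y)
    (trans (cong₂ _∨_ (cong₂ _∧_ bx by) (cong₂ _∨_ (cong₂ _∧_ ex ay) (cong₂ _∧_ ey ax)))
      (sym (does-QKAdj-≢ q r (x≢y ∘ injective ∘ toℕ-injective))))
  where
  injective : ∀ {x y} → π ⟨$⟩ʳ x ≡ π ⟨$⟩ʳ y → x ≡ y
  injective eq = trans (sym (inverseˡ π)) (trans (cong (π ⟨$⟩ˡ_) eq) (inverseˡ π))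

-- Off the diagonal, adjacency is a Boolean formula in three classes, the neighbours of `w`, the set
-- `S` and `w` alone. It is the formula of `does-QKAdj-≢`, so a permutation matching the classes is
-- an isomorphism. Since `w` lies outside `S`, there is room for vertex `q`.
clique+vertex≅ : ∀ {n} (G : Graph n) (w : Fin n) (S : Fin n → Bool) →
  S w ≡ false →
  (∀ {x} → adj G w x ≡ true → S x ≡ true) →
  (∀ {x y} → S x ≡ true → S y ≡ true → x ≢ y → adj G x y ≡ true) →
  (∀ {x y} → x ≢ w → adj G x y ≡ true → S x ≡ true) →
  card S < n × card (adj G w) ≤ card S ×
  G ≅ quasiComplete n (card S) (card (adj G w))
clique+vertex≅ {n} G w S w∉S N⊆S clique support =
  q<n , r≤q , proj₁ match , ≅-from-shape G q r (proj₁ match) (adj G w) S (λ i → does (i ≟ w))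
    (proj₂ match) shape
  where
  q = card S
  r = card (adj G w)
  S∩w : ∀ i → S i ≡ true → does (i ≟ w) ≡ false
  S∩w i Si = dec-false (i ≟ w) λ { refl → contradiction (trans (sym w∉S) Si) λ () }
  r≤q : r ≤ q
  r≤q = sum-mono-≤ go
    where
    go : ∀ i → ⟦ adj G w i ⟧ ≤ ⟦ S i ⟧
    go i with adj G w i in wi
    ... | false = z≤n
    ... | true rewrite N⊆S wi = s≤s z≤n
  q<n : q < n
  q<n = subst (_≤ n)
    (trans (∑-distrib-+ (λ i → ⟦ does (i ≟ w) ⟧) _) (cong (_+ q) (card-singleton w)))
    (ℕ.≤-trans (sum-mono-≤ disjoint) (card≤ (λ i → does (i ≟ w) ∨ S i)))
    where
    disjoint : ∀ i → ⟦ does (i ≟ w) ⟧ + ⟦ S i ⟧ ≤ ⟦ does (i ≟ w) ∨ S i ⟧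
    disjoint i with i ≟ w
    ... | yes refl rewrite w∉S = ℕ.≤-refl
    ... | no _ = ℕ.≤-refl
  match = matching {n} (adj G w) S (λ i → does (i ≟ w))
    (λ i → does (toℕ i ℕ.<? r)) (λ i → does (toℕ i ℕ.<? q)) (λ i → does (toℕ i ℕ.≟ q))
    (λ i → N⊆S) S∩w
    (λ i i<r → dec-true (toℕ i ℕ.<? q) (ℕ.<-≤-trans (does⇒ (toℕ i ℕ.<? r) i<r) r≤q))
    (λ i i<q → dec-false (toℕ i ℕ.≟ q) (ℕ.<⇒≢ (does⇒ (toℕ i ℕ.<? q) i<q)))
    (sym (card-below (ℕ.≤-trans r≤q (ℕ.<⇒≤ q<n))))
    (sym (card-below (ℕ.<⇒≤ q<n)))
    (trans (card-singleton w) (sym (card-toℕ≟ q<n)))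
  shape : ∀ x y → x ≢ y → adj G x y ≡
    (S x ∧ S y) ∨ ((does (x ≟ w) ∧ adj G w y) ∨ (does (y ≟ w) ∧ adj G w x))
  shape x y x≢y with x ≟ w | y ≟ w
  ... | yes refl | yes refl = contradiction refl x≢y
  ... | yes refl | no _ rewrite w∉S with adj G x y
  ...   | true  = refl
  ...   | false = refl
  shape x y x≢y | no _ | yes refl rewrite w∉S with S x
  ...   | true  = adj-sym G x y
  ...   | false = adj-sym G x y
  shape x y x≢y | no x≢w | no y≢w with S x in Sx | S y in Sy
  ...   | true  | true  = clique Sx Sy x≢y
  ...   | false | _ with adj G x y in xy
  ...     | false = refl
  ...     | true  = contradiction (trans (sym Sx) (support x≢w xy)) λ ()
  shape x y x≢y | no x≢w | no y≢w | true | false with adj G x y in xy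
  ...     | false = refl
  ...     | true  =
        contradiction (trans (sym Sy) (support y≢w (trans (adj-sym G y x) xy))) λ ()

-- A vertex joined to the whole clique belongs to a larger clique. This turns the pair with `r ≡ q`,
-- which is no `Decomposition`, into one that is.
quasiComplete-full : ∀ n q → quasiComplete n q q ≅ quasiComplete n (suc q) 0
quasiComplete-full n q = Perm.id , λ i j → does-⇔ (mk⇔ (to (toℕ i) (toℕ j)) (from (toℕ i) (toℕ j)))
  (QKAdj? q q (toℕ i) (toℕ j)) (QKAdj? (suc q) 0 (toℕ i) (toℕ j))
  where
  to : ∀ i j → QKAdj q q i j → QKAdj (suc q) 0 i j
  to i j (i≢j , inj₁ (i<q , j<q)) = i≢j , inj₁ (ℕ.m<n⇒m<1+n i<q , ℕ.m<n⇒m<1+n j<q)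
  to i j (i≢j , inj₂ (inj₁ (refl , j<q))) = i≢j , inj₁ (ℕ.≤-refl , ℕ.m<n⇒m<1+n j<q)
  to i j (i≢j , inj₂ (inj₂ (refl , i<q))) = i≢j , inj₁ (ℕ.m<n⇒m<1+n i<q , ℕ.≤-refl)
  from : ∀ i j → QKAdj (suc q) 0 i j → QKAdj q q i j
  from i j (i≢j , inj₁ (i≤q , j≤q))
    with ℕ.m<1+n⇒m<n∨m≡n i≤q | ℕ.m<1+n⇒m<n∨m≡n j≤q
  ... | inj₁ i<q  | inj₁ j<q  = i≢j , inj₁ (i<q , j<q)
  ... | inj₂ refl | inj₁ j<q  = i≢j , inj₂ (inj₁ (refl , j<q))
  ... | inj₁ i<q  | inj₂ refl = i≢j , inj₂ (inj₂ (refl , i<q))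
  ... | inj₂ refl | inj₂ refl = contradiction refl i≢j
  from i j (i≢j , inj₂ (inj₁ (_ , ())))
  from i j (i≢j , inj₂ (inj₂ (_ , ())))

-- Fractions with a common denominator

/-+ : ∀ a b L .{{_ : NonZero L}} → ℤ.+ a ℚ./ L ℚ.+ ℤ.+ b ℚ./ L ≡ ℤ.+ (a + b) ℚ./ L
/-+ a b (suc l) = ℚ.toℚᵘ-injective (begin
  ℚ.toℚᵘ (ℤ.+ a ℚ./ suc l ℚ.+ ℤ.+ b ℚ./ suc l)
    ≈⟨ ℚ.toℚᵘ-homo-+ (ℤ.+ a ℚ./ suc l) (ℤ.+ b ℚ./ suc l) ⟩
  ℚ.toℚᵘ (ℤ.+ a ℚ./ suc l) ℚᵘ.+ ℚ.toℚᵘ (ℤ.+ b ℚ./ suc l)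
    ≈⟨ ℚᵘ.+-cong (ℚ.toℚᵘ-fromℚᵘ (mkℚᵘ (ℤ.+ a) l)) (ℚ.toℚᵘ-fromℚᵘ (mkℚᵘ (ℤ.+ b) l)) ⟩
  mkℚᵘ (ℤ.+ a) l ℚᵘ.+ mkℚᵘ (ℤ.+ b) l
    ≈⟨ *≡* (trans (lemma (ℤ.+ a) (ℤ.+ b) (ℤ.+ suc l))
         (cong (((ℤ.+ a) ℤ.+ (ℤ.+ b)) ℤ.*_) (sym (ℤ.pos-* (suc l) (suc l))))) ⟩
  mkℚᵘ (ℤ.+ (a + b)) l
    ≈⟨ ℚ.toℚᵘ-fromℚᵘ (mkℚᵘ (ℤ.+ (a + b)) l) ⟨
  ℚ.toℚᵘ (ℤ.+ (a + b) ℚ./ suc l) ∎)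
  where
  open ℚᵘ.≃-Reasoning
  lemma : ∀ x y z → (x ℤ.* z ℤ.+ y ℤ.* z) ℤ.* z ≡ (x ℤ.+ y) ℤ.* (z ℤ.* z)
  lemma = ℤSolver.solve-∀

/-mono-≤ : ∀ {a b} L .{{_ : NonZero L}} → a ≤ b → ℤ.+ a ℚ./ L ℚ.≤ ℤ.+ b ℚ./ L
/-mono-≤ {a} {b} (suc l) a≤b = ℚ.toℚᵘ-cancel-≤
  (ℚᵘ.≤-respˡ-≃ (ℚᵘ.≃-sym (ℚ.toℚᵘ-fromℚᵘ (mkℚᵘ (ℤ.+ a) l)))
    (ℚᵘ.≤-respʳ-≃ (ℚᵘ.≃-sym (ℚ.toℚᵘ-fromℚᵘ (mkℚᵘ (ℤ.+ b) l)))
      (*≤* (ℤ.*-monoʳ-≤-nonNeg (ℤ.+ suc l) (ℤ.+≤+ a≤b)))))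

/-cancel-≤ : ∀ {a b} L .{{_ : NonZero L}} → ℤ.+ a ℚ./ L ℚ.≤ ℤ.+ b ℚ./ L → a ≤ b
/-cancel-≤ {a} {b} (suc l) p = ℤ.drop‿+≤+
  (ℤ.*-cancelʳ-≤-pos (ℤ.+ a) (ℤ.+ b) (ℤ.+ suc l) (ℚᵘ.drop-*≤*
    (ℚᵘ.≤-respˡ-≃ (ℚ.toℚᵘ-fromℚᵘ (mkℚᵘ (ℤ.+ a) l))
      (ℚᵘ.≤-respʳ-≃ (ℚ.toℚᵘ-fromℚᵘ (mkℚᵘ (ℤ.+ b) l)) (ℚ.toℚᵘ-mono-≤ p)))))

/-≡ : ∀ {a b} K L .{{_ : NonZero K}} .{{_ : NonZero L}} → a * L ≡ b * K →
  ℤ.+ a ℚ./ K ≡ ℤ.+ b ℚ./ L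
/-≡ {a} {b} (suc k) (suc l) eq = ℚ.fromℚᵘ-cong {mkℚᵘ (ℤ.+ a) k} {mkℚᵘ (ℤ.+ b) l}
  (*≡* (trans (sym (ℤ.pos-* a (suc l))) (trans (cong ℤ.+_ eq) (ℤ.pos-* b (suc k)))))

sumℚ-/ : ∀ L .{{_ : NonZero L}} {n} (f : Fin n → ℕ) →
  sumℚ (λ i → ℤ.+ f i ℚ./ L) ≡ ℤ.+ sumℕ f ℚ./ L
sumℚ-/ L@(suc _) {zero}  f = /-≡ {0} {0} 1 L refl
sumℚ-/ L {suc n} f = trans (cong (ℤ.+ f zero ℚ./ L ℚ.+_) (sumℚ-/ L (f ∘ suc)))
  (/-+ (f zero) (sumℕ (f ∘ suc)) L)

-- Identification with the graph `QK`

≅-trans : ∀ {n} {G H K : Graph n} → G ≅ H → H ≅ K → G ≅ K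
≅-trans (π , f) (ρ , h) = π Perm.∘ₚ ρ , λ i j → trans (f i j) (h (π ⟨$⟩ʳ i) (π ⟨$⟩ʳ j))

quasiComplete≅QK : ∀ {n m q r} → m ≡ q C 2 + r → r ≤ q → quasiComplete n q r ≅ QK n m
quasiComplete≅QK {n} {m} {q} {r} m≡ r≤q with ℕ.m≤n⇒m<n∨m≡n r≤q
... | inj₁ r<q =
  let q≡ , r≡ = decomposition-unique (decomposition q r m≡ r<q) (decompose m)
  in subst₂ (λ q′ r′ → quasiComplete n q r ≅ quasiComplete n q′ r′) q≡ r≡
       (Perm.id , λ i j → refl)
... | inj₂ refl =
  let m≡′ = trans m≡ (trans (sym ([1+q]C2≡qC2+q q)) (sym (ℕ.+-identityʳ _)))
      q≡ , r≡ = decomposition-unique (decomposition (suc q) 0 m≡′ (s≤s z≤n)) (decompose m)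
  in subst₂ (λ q′ r′ → quasiComplete n q q ≅ quasiComplete n q′ r′) q≡ r≡
       (quasiComplete-full n q)

-- For 0 edges `decompose` yields `q = 1` and `r = 0`: a clique on one vertex, hence no adjacent
-- pair.
edgeless≅QK : ∀ {n} (G : Graph n) → (∀ i → degree G i ≡ 0) → G ≅ QK n (edgeCount G)
edgeless≅QK {n} G d≡0 = subst (λ m → G ≅ QK n m) (sym none) (Perm.id , λ i j →
  trans (no-edge i j) (sym (dec-false (QKAdj? 1 0 (toℕ i) (toℕ j)) λ where
    (i≢j , inj₁ (i<1 , j<1)) → i≢j (trans (ℕ.n<1⇒n≡0 i<1) (sym (ℕ.n<1⇒n≡0 j<1)))
    (_ , inj₂ (inj₁ (_ , ())))
    (_ , inj₂ (inj₂ (_ , ()))))))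
  where
  no-edge : ∀ i j → adj G i j ≡ false
  no-edge i j with adj G i j in ij
  ... | false = refl
  ... | true  = contradiction (d≡0 i) (ℕ.>⇒≢ (card-positive {p = adj G i} ij))
  none : edgeCount G ≡ 0
  none = trans (sum-cong-≗ λ i → card-none {p = λ j → _ ∧ adj G i j} λ j →
           trans (cong (_ ∧_) (no-edge i j)) (∧-zeroʳ _))
         (sum-replicate-zero n)

-- The choice of w and w′, and the improving move

module Descent {n} (G : Graph n) where

  -- `transfer-increases-W` requires the number of non-isolated vertices to be less than `N`, and
  -- that number can be `n`.
  open Weight (suc n)

  active : Fin n → Bool
  active i = does (0 ℕ.<? degree G i)

  adj⇒active : ∀ {i j} → adj G i j ≡ true → active j ≡ true
  adj⇒active {i} {j} ij = dec-true (0 ℕ.<? degree G j)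
    (card-positive {p = adj G j} (trans (adj-sym G j i) ij))

  active⇒positive : ∀ {i} → active i ≡ true → 0 < degree G i
  active⇒positive {i} = does⇒ (0 ℕ.<? degree G i)

  module _ {w : Fin n} (w-active : active w ≡ true)
    (w-min : ∀ i → active i ≡ true → degree G w ≤ degree G i) where

    S : Fin n → Bool
    S i = not (does (i ≟ w)) ∧ active i

    S-intro : ∀ {i} → i ≢ w → active i ≡ true → S i ≡ true
    S-intro {i} i≢w i-active =
      cong₂ (λ a b → not a ∧ b) (dec-false (i ≟ w) i≢w) i-active

    S⇒active : ∀ {i} → S i ≡ true → active i ≡ true
    S⇒active {i} = ∧-conicalʳ (not (does (i ≟ w))) (active i)

    w∉S : S w ≡ false
    w∉S = cong (λ a → not a ∧ active w) (dec-true (w ≟ w) refl)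

    -- Ranges over `S`, thus without `w`: the vertex that gives up edges must not receive one.
    -- Restricted to `S` the relation is symmetric, so a missed vertex is again deficient.
    missed : Fin n → Fin n → Bool
    missed i j = S j ∧ (not (does (j ≟ i)) ∧ not (adj G i j))

    missed-intro : ∀ {i j} → S j ≡ true → j ≢ i → adj G i j ≡ false → missed i j ≡ true
    missed-intro {i} {j} Sj j≢i ¬ij = cong₂ _∧_ Sj
      (cong₂ (λ a b → not a ∧ not b) (dec-false (j ≟ i) j≢i) ¬ij)

    missed⇒S : ∀ {i j} → missed i j ≡ true → S j ≡ true
    missed⇒S {i} {j} = ∧-conicalˡ (S j) _

    missed⇒≢ : ∀ {i j} → missed i j ≡ true → j ≢ i
    missed⇒≢ {i} {j} m refl = contradiction
      (trans (sym (∧-conicalˡ _ (not (adj G i i)) (∧-conicalʳ (S i) _ m)))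
        (cong not (dec-true (i ≟ i) refl))) λ ()

    missed⇒¬adj : ∀ {i j} → missed i j ≡ true → adj G i j ≡ false
    missed⇒¬adj {i} {j} m = not-injective
      (∧-conicalʳ (not (does (j ≟ i))) _ (∧-conicalʳ (S j) _ m))

    deficient : Fin n → Bool
    deficient i = S i ∧ does (0 ℕ.<? card (missed i))

    deficient-intro : ∀ {i j} → S i ≡ true → missed i j ≡ true → deficient i ≡ true
    deficient-intro {i} {j} Si ij = cong₂ _∧_ Si
      (dec-true (0 ℕ.<? card (missed i)) (card-positive {p = missed i} {j} ij))

    clique⇒≅QK : (∀ i → deficient i ≡ false) → G ≅ QK n (edgeCount G)
    clique⇒≅QK none =
      let q<n , r≤q , iso = clique+vertex≅ G w S w∉S
            (λ {x} wx → S-intro (λ { refl → contradiction (trans (sym wx) (adj-irrefl G w)) λ () })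
              (adj⇒active wx))
            clique
            (λ {x} {y} x≢w xy → S-intro x≢w (adj⇒active (trans (adj-sym G y x) xy)))
          K = quasiComplete n (card S) (card (adj G w))
      in ≅-trans {G = G} {K} {QK n (edgeCount G)} iso
        (quasiComplete≅QK (trans (edgeCount-≅ G K iso)
          (edgeCount-quasiComplete {n} r≤q (inj₁ q<n))) r≤q)
      where
      clique : ∀ {x y} → S x ≡ true → S y ≡ true → x ≢ y → adj G x y ≡ true
      clique {x} {y} Sx Sy x≢y with adj G x y in xy
      ... | true  = refl
      ... | false = contradiction
        (trans (sym (none x)) (deficient-intro {x} {y} Sx (missed-intro {x} {y} Sy (x≢y ∘ sym) xy))) λ ()

    k : ℕ
    k = card active

    degree<k : ∀ {i} → active i ≡ true → degree G i < k
    degree<k {i} i-active = subst (_≤ k)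
      (trans (∑-distrib-+ (λ j → ⟦ does (j ≟ i) ⟧) _) (cong (_+ degree G i) (card-singleton i)))
      (sum-mono-≤ pointwise)
      where
      pointwise : ∀ j → ⟦ does (j ≟ i) ⟧ + ⟦ adj G i j ⟧ ≤ ⟦ active j ⟧
      pointwise j with j ≟ i | adj G i j in ij
      ... | yes refl | true  = contradiction (trans (sym ij) (adj-irrefl G i)) λ ()
      ... | yes refl | false rewrite i-active = s≤s z≤n
      ... | no _     | true  rewrite adj⇒active ij = s≤s z≤n
      ... | no _     | false = z≤n

    -- The vertex itself, its neighbours and the vertices it misses are disjoint sets of active
    -- vertices. This keeps the new degree of w′ within P.
    degree+missed<k : ∀ {i} → active i ≡ true → degree G i + card (missed i) < k
    degree+missed<k {i} i-active = subst (_≤ k)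
      (trans (∑-distrib-+ (λ j → ⟦ does (j ≟ i) ⟧) _)
        (cong₂ _+_ (card-singleton i) (∑-distrib-+ (λ j → ⟦ adj G i j ⟧) _)))
      (sum-mono-≤ pointwise)
      where
      pointwise : ∀ j → ⟦ does (j ≟ i) ⟧ + (⟦ adj G i j ⟧ + ⟦ missed i j ⟧) ≤ ⟦ active j ⟧
      pointwise j = pack (does (j ≟ i)) (adj G i j) (missed i j) (active j)
        (λ j≟i → at-i (does⇒ (j ≟ i) j≟i))
        (λ ij → ¬-not (λ m → contradiction (trans (sym ij) (missed⇒¬adj {i} {j} m)) λ ()) ,
                adj⇒active ij)
        (λ m → S⇒active {j} (missed⇒S {i} {j} m))
        where
        at-i : j ≡ i → adj G i j ≡ false × missed i j ≡ false × active j ≡ true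
        at-i refl = adj-irrefl G i , ¬-not (λ m → missed⇒≢ {i} {i} m refl) , i-active
        pack : ∀ b e m a → (b ≡ true → e ≡ false × m ≡ false × a ≡ true) →
          (e ≡ true → m ≡ false × a ≡ true) → (m ≡ true → a ≡ true) →
          ⟦ b ⟧ + (⟦ e ⟧ + ⟦ m ⟧) ≤ ⟦ a ⟧
        pack true  e     m     a b⇒ _ _ with refl , refl , refl ← b⇒ refl = s≤s z≤n
        pack false true  m     a _ e⇒ _ with refl , refl ← e⇒ refl = s≤s z≤n
        pack false false true  a _ _ m⇒ with refl ← m⇒ refl = s≤s z≤n
        pack false false false a _ _ _ = z≤n

    -- An active vertex that is neither a neighbour of `i` nor missed by it can only be `i` or `w`,
    -- whence the 2.
    k≤2+degree+missed : ∀ i → k ≤ 2 + (degree G i + card (missed i))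
    k≤2+degree+missed i = subst (k ≤_)
      (trans (∑-distrib-+ (λ j → ⟦ does (j ≟ i) ⟧ + ⟦ does (j ≟ w) ⟧) _)
        (cong₂ _+_
          (trans (∑-distrib-+ (λ j → ⟦ does (j ≟ i) ⟧) _)
            (cong₂ _+_ (card-singleton i) (card-singleton w)))
          (∑-distrib-+ (λ j → ⟦ adj G i j ⟧) _)))
      (sum-mono-≤ pointwise)
      where
      pointwise : ∀ j → ⟦ active j ⟧ ≤
        (⟦ does (j ≟ i) ⟧ + ⟦ does (j ≟ w) ⟧) + (⟦ adj G i j ⟧ + ⟦ missed i j ⟧)
      pointwise j = cover (active j) (does (j ≟ i)) (does (j ≟ w)) (adj G i j) (missed i j)
        λ j-active j≢i j≢w ¬ij → missed-intro {i} {j}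
          (S-intro (does⇒¬ (j ≟ w) j≢w) j-active) (does⇒¬ (j ≟ i) j≢i) ¬ij
        where
        cover : ∀ a b d e m → (a ≡ true → b ≡ false → d ≡ false → e ≡ false → m ≡ true) →
          ⟦ a ⟧ ≤ (⟦ b ⟧ + ⟦ d ⟧) + (⟦ e ⟧ + ⟦ m ⟧)
        cover false _     _     _     _ _ = z≤n
        cover true  true  _     _     _ _ = s≤s z≤n
        cover true  false true  _     _ _ = s≤s z≤n
        cover true  false false true  _ _ = s≤s z≤n
        cover true  false false false m h rewrite h refl refl refl refl = s≤s z≤n

    improve : ∀ {w′} → deficient w′ ≡ true →
      (∀ i → deficient i ≡ true → degree G w′ ≤ degree G i) →
      ∃ λ H → edgeCount H ≡ edgeCount G × W G < W H
    improve {w′} w′-deficient w′-min =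
      T.transfer , T.edgeCount-transfer ∣A∣≡∣B∣ ,
      transfer-increases-W G {A = A} {B} A⊆N (missed⇒¬adj {w′} ∘ B⊆M _) w′∉B
        {p} (subst (_< suc n) (sym P≡k) (s≤s (card≤ active)))
        w≢w′ w∉B ∣A∣≡∣B∣ (subst (0 <_) (sym ∣A∣) 0<j)
        (w-min w′ w′-active) d≤P
        -- A vertex of `B` misses w′ as w′ misses it, so it competes in the choice of w′ and has
        -- degree at least `D`.
        (λ {i} Bi → w′-min i (deficient-intro {i} {w′} (missed⇒S {w′} {i} (B⊆M i Bi))
          (missed-intro {i} {w′} w′∈S (missed⇒≢ {w′} {i} (B⊆M i Bi) ∘ sym)
            (trans (adj-sym G i w′) (missed⇒¬adj {w′} {i} (B⊆M i Bi))))))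
        (subst (λ a → D + a ≤ suc p) (sym ∣A∣) D+j≤P)
        (subst (λ a → a ≡ δ ⊎ p ≤ D + a) (sym ∣A∣) alt)
      where
      δ = degree G w
      D = degree G w′
      t = card (missed w′)
      j = δ ⊓ t
      p = k ∸ 2
      w′∈S : S w′ ≡ true
      w′∈S = ∧-conicalˡ (S w′) _ w′-deficient
      w′-active : active w′ ≡ true
      w′-active = S⇒active {w′} w′∈S
      w≢w′ : w ≢ w′
      w≢w′ refl = contradiction (trans (sym w∉S) w′∈S) λ ()
      0<t : 0 < t
      0<t = does⇒ (0 ℕ.<? t) (∧-conicalʳ (S w′) _ w′-deficient)
      0<j : 0 < j
      0<j = ℕ.⊓-glb (active⇒positive w-active) 0<t
      P≡k : suc (suc p) ≡ k
      P≡k = ℕ.m+[n∸m]≡n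
        (ℕ.≤-trans (s≤s (active⇒positive w-active)) (degree<k w-active))
      D+j≤P : D + j ≤ suc p
      D+j≤P = ℕ.≤-trans (ℕ.+-monoʳ-≤ D (ℕ.m⊓n≤n δ t))
        (s≤s⁻¹ (subst (D + t <_) (sym P≡k) (degree+missed<k w′-active)))
      d≤P : ∀ i → degree G i ≤ suc p
      d≤P i with 0 ℕ.<? degree G i
      ... | yes 0<d = s≤s⁻¹ (subst (degree G i <_) (sym P≡k)
              (degree<k (dec-true (0 ℕ.<? degree G i) 0<d)))
      ... | no  0≮d = ℕ.≤-trans (ℕ.≮⇒≥ 0≮d) z≤n
      alt : j ≡ δ ⊎ p ≤ D + j
      alt with ℕ.≤-total δ t
      ... | inj₁ δ≤t = inj₁ (ℕ.m≤n⇒m⊓n≡m δ≤t)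
      ... | inj₂ t≤δ = inj₂ (subst (λ x → p ≤ D + x) (sym (ℕ.m≥n⇒m⊓n≡n t≤δ))
              (s≤s⁻¹ (s≤s⁻¹ (subst (_≤ 2 + (D + t)) (sym P≡k) (k≤2+degree+missed w′)))))
      subA = subset-of-card (adj G w) (ℕ.m⊓n≤m δ t)
      subB = subset-of-card (missed w′) (ℕ.m⊓n≤n δ t)
      A = proj₁ subA
      B = proj₁ subB
      A⊆N : ∀ {i} → A i ≡ true → adj G w i ≡ true
      A⊆N {i} = proj₁ (proj₂ subA) i
      B⊆M : ∀ i → B i ≡ true → missed w′ i ≡ true
      B⊆M = proj₁ (proj₂ subB)
      ∣A∣ : card A ≡ j
      ∣A∣ = proj₂ (proj₂ subA)
      ∣A∣≡∣B∣ : card A ≡ card B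
      ∣A∣≡∣B∣ = trans ∣A∣ (sym (proj₂ (proj₂ subB)))
      w′∉B : B w′ ≡ false
      w′∉B with B w′ in Bw′
      ... | false = refl
      ... | true  = contradiction refl (missed⇒≢ {w′} (B⊆M w′ Bw′))
      w∉B : B w ≡ false
      w∉B with B w in Bw
      ... | false = refl
      ... | true  = trans (sym (missed⇒S {w′} (B⊆M w Bw))) w∉S
      module T = Transfer G {A = A} {B} A⊆N (λ {i} Bi → missed⇒¬adj {w′} (B⊆M i Bi)) w′∉B

  -- Serves both halves of the theorem: repeating the improvement proves minimality, and a minimizer
  -- rules the improvement out, which leaves the isomorphism.
  optimal-or-improvable : G ≅ QK n (edgeCount G) ⊎
    ∃ λ H → edgeCount H ≡ edgeCount G × W G < W H
  optimal-or-improvable with argmin active (degree G)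
  ... | inj₁ none = inj₁ (edgeless≅QK G λ i → isolated i (none i))
    where
    isolated : ∀ i → active i ≡ false → degree G i ≡ 0
    isolated i inactive with 0 ℕ.<? degree G i
    ... | no  0≮d = ℕ.n≤0⇒n≡0 (ℕ.≮⇒≥ 0≮d)
    ... | yes 0<d = contradiction
            (trans (sym inactive) (dec-true (0 ℕ.<? degree G i) 0<d)) λ ()
  ... | inj₂ (w , w-active , w-min)
    with argmin (deficient w-active w-min) (degree G)
  ...   | inj₁ none = inj₁ (clique⇒≅QK w-active w-min none)
  ...   | inj₂ (w′ , w′-deficient , w′-min) =
          inj₂ (improve w-active w-min w′-deficient w′-min)

-- From reciprocals back to the rational sum

module _ (n : ℕ) where

  open Reciprocals (suc n)
  open Weight (suc n)

  -- The numerator of Σ_g over `L`, complementary to `W` by `V+W`. Being a natural number, it can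
  -- measure the descent.
  V : Graph n → ℕ
  V G = sumℕ λ i → degree G i * c (degree G i)

  V+W : ∀ G → V G + W G ≡ sumℕ {n} λ _ → L
  V+W G = trans (sym (∑-distrib-+ (λ i → degree G i * c (degree G i)) _))
    (sum-cong-≗ λ i → trans (ℕ.+-comm _ (c (degree G i)))
      (trans (ℕ.*-comm (suc (degree G i)) (c (degree G i)))
        (c-inverse (s≤s (card≤ (adj G i))))))

  W-<⇒V-< : ∀ G H → W G < W H → V H < V G
  W-<⇒V-< G H W<W = ℕ.+-cancelʳ-< (W G) _ _ (begin-strict
    V H + W G    <⟨ ℕ.+-monoʳ-< (V H) W<W ⟩
    V H + W H    ≡⟨ trans (V+W H) (sym (V+W G)) ⟩
    V G + W G    ∎)
    where open ℕ.≤-Reasoning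

  Σg≡V/L : ∀ (G : Graph n) → Σ[ g ] (degree G) ≡ ℤ.+ V G ℚ./ L
  Σg≡V/L G = trans (sumℚ-cong-≗ g≡)
    (sumℚ-/ L λ i → degree G i * c (degree G i))
    where
    g≡ : ∀ i → g (degree G i) ≡ ℤ.+ (degree G i * c (degree G i)) ℚ./ L
    g≡ i = /-≡ {degree G i} {degree G i * c (degree G i)} (suc (degree G i)) L (begin
      degree G i * L
        ≡⟨ cong (degree G i *_) (c-inverse (s≤s (card≤ (adj G i)))) ⟨
      degree G i * (c (degree G i) * suc (degree G i))
        ≡⟨ ℕ.*-assoc (degree G i) _ _ ⟨
      degree G i * c (degree G i) * suc (degree G i) ∎)
      where open ≡-Reasoning

  V-≤⇒Σg-≤ : ∀ G H → V G ≤ V H → Σ[ g ] (degree G) ℚ.≤ Σ[ g ] (degree H)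
  V-≤⇒Σg-≤ G H V≤V = subst₂ ℚ._≤_ (sym (Σg≡V/L G)) (sym (Σg≡V/L H)) (/-mono-≤ L V≤V)

  Σg-≤⇒V-≤ : ∀ G H → Σ[ g ] (degree G) ℚ.≤ Σ[ g ] (degree H) → V G ≤ V H
  Σg-≤⇒V-≤ G H Σ≤Σ = /-cancel-≤ L (subst₂ ℚ._≤_ (Σg≡V/L G) (Σg≡V/L H) Σ≤Σ)

  -- Each improvement raises `W`, hence lowers `V`, and keeps the number of edges, so the graph to
  -- be reached stays the same throughout the recursion.
  QK-minimizes-V : ∀ H → Acc _<_ (V H) → V (QK n (edgeCount H)) ≤ V H
  QK-minimizes-V H (acc rec) with Descent.optimal-or-improvable H
  ... | inj₁ iso = ℕ.≤-reflexive
          (sym (∑-degree-≅ H (QK n (edgeCount H)) iso λ d → d * c d))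
  ... | inj₂ (K , same , W<W) = ℕ.<⇒≤ (ℕ.≤-<-trans
          (subst (λ m → V (QK n m) ≤ V K) same (QK-minimizes-V K (rec V<V))) V<V)
          where V<V = W-<⇒V-< H K W<W

mainTheorem3 : ∀ (n m : ℕ) → 0 < n → m ≤ n C 2 → UniquelyMinimizes g m (QK n m)
mainTheorem3 n m 0<n m≤nC2 =
  (edgeCount-QK n m 0<n m≤nC2 , λ { H refl →
    V-≤⇒Σg-≤ n (QK n m) H (QK-minimizes-V n H (<-wellFounded _)) }) ,
  unique
  where
  unique : ∀ H → Minimizes g m H → H ≅ QK n m
  unique H (refl , minimal) with Descent.optimal-or-improvable H
  ... | inj₁ iso = iso
  ... | inj₂ (K , same , W<W) = contradiction
          (Σg-≤⇒V-≤ n H K (minimal K same)) (ℕ.<⇒≱ (W-<⇒V-< n H K W<W))
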